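{- Let $q$ be a prime power with $q\equiv 1\pmod 4$ and characteristic $p$, let $k$ be a divisor of $q-1$ with $3<k<q-1$ and $k<p$, and set $e=(q-1)/k$. Let $B$ be the subgroup of order $k$ of $\mathbb{F}_q^\times$. (i) If $e$ is odd, then the $\mathrm{PSL}(2,q)$-orbit of $B$ is the block set of a $3$-$(q+1,k,\lambda)$ design with $\lambda=\frac12(k-1)(k-2)$. (ii) If $e$ is even and the $\mathrm{PSL}(2,q)$-orbit of $B$ is the block set of a $3$-$(q+1,k,\lambda)$ design, then $\lambda=\frac14(k-1)(k-2)$.
   Context: $\mathrm{PSL}(2,q)$ acts on the projective line $\mathrm{PG}(1,q)=\mathbb{F}_q\cup\{\infty\}$ (with $q+1$ points) by linear fractional transformations $z\mapsto (az+b)/(cz+d)$. The orbit of $B$ is $\{gB:g\in\mathrm{PSL}(2,q)\}$. -}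

module Defs where

open import Data.Nat as ℕ using (ℕ; zero; suc)
open import Data.Fin as Fin using (Fin)
open import Data.Fin.Properties using (any?)
open import Data.Fin.Subset using (Subset; _∈_; _∉_; ∣_∣; _⊆_)
open import Data.Fin.Subset.Properties using (_∈?_; _⊆?_)
open import Data.Vec using (tabulate)
open import Data.List using (List; length; filter)
open import Data.List.Relation.Unary.Unique.Propositional using (Unique)
import Data.List.Membership.Propositional as LM
open import Data.Product using (Σ; ∃; _×_; _,_)
open import Relation.Nullary using (¬_; ⌊_⌋)
open import Relation.Nullary.Decidable using (_×-dec_)
open import Relation.Binary.PropositionalEquality using (_≡_)
open import Algebra.Structures using (IsCommutativeRing)
open import Function.Bundles using (_⇔_)

-- A finite field with q elements, carrier Fin q, equality ≡.
-- inv is total with inv 0 arbitrary; only x ≠ 0 → x * inv x ≡ 1 is required.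
record FiniteField (q : ℕ) : Set where
  field
    _+_ _*_ : Fin q → Fin q → Fin q
    -_ inv  : Fin q → Fin q
    0# 1#   : Fin q
    isCommutativeRing : IsCommutativeRing _≡_ _+_ _*_ -_ 0# 1#
    0≢1     : ¬ (0# ≡ 1#)
    inverse : ∀ x → ¬ (x ≡ 0#) → (x * inv x) ≡ 1#

  infixl 7 _*_
  infixl 6 _+_ _-_

  _-_ : Fin q → Fin q → Fin q
  x - y = x + (- y)

  _·1 : ℕ → Fin q
  zero ·1 = 0#
  suc n ·1 = 1# + n ·1

module _ {q : ℕ} (F : FiniteField q) where
  open FiniteField F

  HasCharacteristic : ℕ → Set
  HasCharacteristic p = Data.Nat.Primality.Prime p × (p ·1 ≡ 0#)
    where import Data.Nat.Primality

  IsMulSubgroupOfOrder : ℕ → Subset q → Set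
  IsMulSubgroupOfOrder k B =
    (0# ∉ B) × (1# ∈ B)
    × (∀ x y → x ∈ B → y ∈ B → (x * y) ∈ B)
    × (∀ x → x ∈ B → inv x ∈ B)
    × (∣ B ∣ ≡ k)

  -- Projective line PG(1,q) = F_q ∪ {∞}, encoded as Fin (suc q):
  -- zero = ∞, suc x = the field element x.
  Point : Set
  Point = Fin (suc q)

  ∞ : Point
  ∞ = Fin.zero

  act : Fin q → Fin q → Fin q → Fin q → Point → Point
  act a b c d Fin.zero with c Fin.≟ 0#
  ... | Relation.Nullary.yes _ = ∞
  ... | Relation.Nullary.no  _ = Fin.suc (a * inv c)
  act a b c d (Fin.suc z) with (c * z + d) Fin.≟ 0#
  ... | Relation.Nullary.yes _ = ∞
  ... | Relation.Nullary.no  _ = Fin.suc ((a * z + b) * inv (c * z + d))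

  image : Fin q → Fin q → Fin q → Fin q → Subset q → Subset (suc q)
  image a b c d B = tabulate λ y →
    ⌊ any? (λ x → (x ∈? B) ×-dec (act a b c d (Fin.suc x) Fin.≟ y)) ⌋

  -- S lies in the PSL(2,q)-orbit of B (PSL(2,q) acts through SL(2,q))
  InOrbit : Subset q → Subset (suc q) → Set
  InOrbit B S = Σ (Fin q) λ a → Σ (Fin q) λ b → Σ (Fin q) λ c → Σ (Fin q) λ d →
    (a * d - b * c ≡ 1#) × (S ≡ image a b c d B)

  IsOrbitList : Subset q → List (Subset (suc q)) → Set
  IsOrbitList B L = Unique L × (∀ S → (S LM.∈ L) ⇔ InOrbit B S)

IsDesign : (t v k lam : ℕ) → List (Subset v) → Set
IsDesign t v k lam L =
  (∀ S → S LM.∈ L → ∣ S ∣ ≡ k)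
  × (∀ (T : Subset v) → ∣ T ∣ ≡ t → length (filter (T ⊆?_) L) ≡ lam)

-- For distinct u, v in B∖{1}, let N(u,v) be the matrix sending 1, u, v to ∞, 0, 1, and
-- let h send ∞, 0, 1 to three given points. Every block through these points is
-- h N(u,v) B for some (u,v): rotate B so that the preimage of the first point is 1.
-- The pair is unique up to (u,v) ↦ (1/u,1/v), because the stabiliser of B consists of
-- the maps z ↦ bz and z ↦ b/z with b ∈ B: if (ax+b)/(cx+d) preserves B, then
-- (ax+b)^k − (cx+d)^k vanishes on the roots of x^k − 1, and as k < p the comparison of
-- the coefficients of x and x² gives b = c = 0 or a = d = 0. Hence twice the number of
-- blocks through the three points is the number of those (u,v) for which h N(u,v) B
-- lies in the PSL-orbit of B. If e is odd, B contains a nonsquare and all (k−1)(k−2)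
-- pairs qualify. If e is even, B and −1 consist of squares and the pairs with
-- det(h N(u,v)) a square qualify; passing from {∞,0,1} to {∞,0,t} with t a nonsquare
-- selects the complementary pairs, so that 2λ + 2λ = (k−1)(k−2).
module Submission where

open import Defs
open import Algebra.Bundles using (CommutativeRing)
import Algebra.Properties.AbelianGroup as AbelianGroupProperties
import Algebra.Properties.CommutativeSemiring.Exp as Exp
import Algebra.Properties.Ring as RingProperties
import Algebra.Properties.Semiring.Mult as UnoptimisedMult
import Algebra.Properties.Semiring.Mult.TCOptimised as Mult
import Algebra.Solver.Ring as RingSolver
open import Algebra.Solver.Ring.AlmostCommutativeRing using (fromCommutativeRing; _-Raw-AlmostCommutative⟶_)
open import Data.Bool as Bool using (true; false)
open import Data.Empty using (⊥)
open import Data.Fin as Fin using (Fin)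
import Data.Fin.Properties as Fin
open import Data.Fin.Subset using (Subset; _∈_; _⊆_; ∣_∣; ⁅_⁆; _∪_)
open import Data.Fin.Subset.Properties
  using (_∈?_; _⊆?_; ⊆-antisym; x∈⁅x⁆; x∈⁅y⁆⇒x≡y; x∈p∪q⁻; x∈p∪q⁺)
open import Data.Integer as ℤ using (ℤ; -[1+_]; _⊖_) renaming (+_ to pos)
import Data.Integer.Properties as ℤ
open import Data.List as List using (List; []; _∷_; length; filter; foldr; allFin; cartesianProduct)
open import Data.List.Membership.Propositional using () renaming (_∈_ to _∈ˡ_; _∉_ to _∉ˡ_)
open import Data.List.Membership.Propositional.Properties
  using (∈-map⁺; ∈-map⁻; ∈-filter⁺; ∈-filter⁻; ∈-allFin; ∈-cartesianProduct⁺; ∈-cartesianProduct⁻)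
open import Data.List.Membership.Propositional.Properties.WithK using (unique∧set⇒bag)
import Data.List.Properties as List
open import Data.List.Relation.Binary.BagAndSetEquality using (∼bag⇒↭)
open import Data.List.Relation.Binary.Permutation.Propositional as ↭ using (_↭_)
open import Data.List.Relation.Binary.Permutation.Propositional.Properties using (↭-length)
open import Data.List.Relation.Unary.All as All using ([]; _∷_)
open import Data.List.Relation.Unary.All.Properties using (¬Any⇒All¬)
open import Data.List.Relation.Unary.AllPairs using ([]; _∷_)
open import Data.List.Relation.Unary.Any using (here; there)
open import Data.List.Relation.Unary.Unique.Propositional using (Unique)
import Data.List.Relation.Unary.Unique.Propositional.Properties as Unique
import Data.Maybe as Maybe
open import Data.Nat as ℕ using (ℕ; zero; suc; _%_; _/_)
open import Data.Nat.Coprimality using (prime⇒coprime; coprime-Bézout)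
open import Data.Nat.DivMod using (m≡m%n+[m/n]*n; m*n/n≡m)
open import Data.Nat.GCD using (module Bézout)
import Data.Nat.Properties as ℕ
open import Data.Nat.Solver using (module +-*-Solver)
open import Data.Product using (Σ; ∃; _×_; _,_; proj₁; proj₂; uncurry)
import Data.Product.Properties as Product
open import Data.Sum as Sum using (_⊎_; inj₁; inj₂)
open import Data.Vec using (Vec; []; _∷_; here; there; _∷ʳ_; initLast; zipWith; replicate)
import Data.Vec.Properties as Vec
open import Function using (_∘_; id; mk⇔)
open import Function.Bundles using (Equivalence)
open import Level using (Level; 0ℓ)
open import Relation.Binary.Consequences using (dec⇒weaklyDec)
open import Relation.Binary.Definitions using (DecidableEquality)
open import Relation.Binary.PropositionalEquality
open import Relation.Nullary using (¬_; isYes; Dec; yes; no; contradiction)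
open import Relation.Nullary.Decidable using (¬?; decidable-stable; _×-dec_; toWitness; fromWitness)
open import Relation.Unary using (Pred; Decidable)

-- Square classes of determinants decide both parts. Scaling a matrix multiplies its determinant by
-- a square, so an invertible matrix acts as an element of PSL(2,q) exactly when its determinant is
-- a square. The stabilising maps z ↦ bz and z ↦ b/z have determinants b and -b. A nonsquare b in B
-- therefore lets any matrix be corrected into PSL without moving its image of B. If instead all of
-- B and -1 are squares, which for -1 is where q ≡ 1 (mod 4) enters, then all matrices with the same
-- image of B have determinants in one square class, and membership in the orbit can be read off
-- from any of them.
--
-- The function `act` tests whether a denominator vanishes, so composing it directly would branch at
-- every step. The relation `Maps` on homogeneous coordinates takes its place: adjugates and scalar
-- multiples become polynomial identities, and composition needs a case split only on the middle
-- point.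

private variable
  ℓ ℓ′ : Level
  A : Set ℓ
  C : Set ℓ′

-- Counting with duplicate-free lists.

unique-↭ : {xs ys : List A} → Unique xs → Unique ys →
  (∀ {z} → z ∈ˡ xs → z ∈ˡ ys) → (∀ {z} → z ∈ˡ ys → z ∈ˡ xs) → xs ↭ ys
unique-↭ ux uy f g = ∼bag⇒↭ (unique∧set⇒bag ux uy (mk⇔ f g))

unique-length : {xs ys : List A} → Unique xs → Unique ys →
  (∀ {z} → z ∈ˡ xs → z ∈ˡ ys) → (∀ {z} → z ∈ˡ ys → z ∈ˡ xs) → length xs ≡ length ys
unique-length ux uy f g = ↭-length (unique-↭ ux uy f g)

∉⇒unique-∷ : {x : A} {xs : List A} → x ∉ˡ xs → Unique xs → Unique (x ∷ xs)
∉⇒unique-∷ x∉ u = ¬Any⇒All¬ _ x∉ ∷ u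

module _ (_≟_ : DecidableEquality A) where
  open import Data.List.Membership.DecPropositional _≟_ using () renaming (_∈?_ to _∈ˡ?_)

  unique-⊆-length : {xs ys : List A} → Unique xs → Unique ys →
    (∀ {z} → z ∈ˡ xs → z ∈ˡ ys) → length xs ℕ.≤ length ys
  unique-⊆-length {xs} {ys} ux uy f = ℕ.≤-trans
    (ℕ.≤-reflexive (unique-length ux (Unique.filter⁺ (_∈ˡ? xs) uy)
      (λ z∈ → ∈-filter⁺ (_∈ˡ? xs) (f z∈) z∈)
      (λ z∈ → proj₂ (∈-filter⁻ (_∈ˡ? xs) {xs = ys} z∈))))
    (List.length-filter (_∈ˡ? xs) ys)

  -- A member of `ys` missing from `xs` could be put in front of `xs`, giving a duplicate-free list
  -- inside `ys` that is longer than `ys`.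
  unique-⊆-reverse : {xs ys : List A} → Unique xs → Unique ys →
    (∀ {z} → z ∈ˡ xs → z ∈ˡ ys) → length ys ℕ.≤ length xs → ∀ {z} → z ∈ˡ ys → z ∈ˡ xs
  unique-⊆-reverse {xs} ux uy f le {z} z∈ with z ∈ˡ? xs
  ... | yes z∈xs = z∈xs
  ... | no z∉xs = contradiction
    (ℕ.≤-trans (unique-⊆-length (∉⇒unique-∷ z∉xs ux) uy λ { (here refl) → z∈ ; (there w) → f w }) le)
    ℕ.1+n≰n

length-filter-¬ : {P : Pred A ℓ′} (P? : Decidable P) (xs : List A) →
  length (filter P? xs) ℕ.+ length (filter (¬? ∘ P?) xs) ≡ length xs
length-filter-¬ P? [] = refl
length-filter-¬ P? (x ∷ xs) with P? x
... | yes _ = cong suc (length-filter-¬ P? xs)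
... | no  _ = trans (ℕ.+-suc _ _) (cong suc (length-filter-¬ P? xs))

length-filter-⇔ : {P Q : Pred A ℓ′} (P? : Decidable P) (Q? : Decidable Q) (xs : List A) →
  (∀ {x} → x ∈ˡ xs → P x → Q x) → (∀ {x} → x ∈ˡ xs → Q x → P x) →
  length (filter P? xs) ≡ length (filter Q? xs)
length-filter-⇔ P? Q? [] f g = refl
length-filter-⇔ P? Q? (x ∷ xs) f g with P? x | Q? x
... | yes _  | yes _ = cong suc (length-filter-⇔ P? Q? xs (f ∘ there) (g ∘ there))
... | no  _  | no  _ = length-filter-⇔ P? Q? xs (f ∘ there) (g ∘ there)
... | yes px | no ¬q = contradiction (f (here refl) px) ¬q
... | no ¬p  | yes q = contradiction (g (here refl) q) ¬p

module _ (_≟_ : DecidableEquality C) (f : A → C) where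

  -- Induction on `ys`: the fibre over its head is split off and counted. The other elements map
  -- into the tail, and the fibres there lose nothing because the head does not recur in `ys`.
  length-fibres : (m : ℕ) (xs : List A) (ys : List C) → Unique xs → Unique ys →
    (∀ {x} → x ∈ˡ xs → f x ∈ˡ ys) →
    (∀ {y} → y ∈ˡ ys → length (filter (λ x → f x ≟ y) xs) ≡ m) →
    length xs ≡ length ys ℕ.* m
  length-fibres m [] [] _ _ _ _ = refl
  length-fibres m (x ∷ xs) [] _ _ into _ with () ← into (here refl)
  length-fibres m xs (y ∷ ys) ux uy@(_ ∷ uys) into fib = begin
    length xs                                       ≡⟨ length-filter-¬ at-y? xs ⟨
    length (filter at-y? xs) ℕ.+ length rest          ≡⟨ cong₂ ℕ._+_ (fib (here refl)) ih ⟩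
    m  ℕ.+ length ys ℕ.* m                               ∎
    where
    open ≡-Reasoning
    at-y? : Decidable (λ x → f x ≡ y)
    at-y? x = f x ≟ y
    rest = filter (¬? ∘ at-y?) xs
    into′ : ∀ {x} → x ∈ˡ rest → f x ∈ˡ ys
    into′ x∈ with ∈-filter⁻ (¬? ∘ at-y?) {xs = xs} x∈
    ... | x∈xs , fx≢y with into x∈xs
    ...   | here eq = contradiction eq fx≢y
    ...   | there t = t
    fib′ : ∀ {y′} → y′ ∈ˡ ys → length (filter (λ x → f x ≟ y′) rest) ≡ m
    fib′ {y′} y′∈ = trans
      (unique-length
        (Unique.filter⁺ _ (Unique.filter⁺ _ ux)) (Unique.filter⁺ _ ux)
        (λ z∈ → let z∈rest , e = ∈-filter⁻ (λ x → f x ≟ y′) {xs = rest} z∈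
                in ∈-filter⁺ _ (proj₁ (∈-filter⁻ (¬? ∘ at-y?) {xs = xs} z∈rest)) e)
        (λ z∈ → let z∈xs , e = ∈-filter⁻ (λ x → f x ≟ y′) {xs = xs} z∈
                in ∈-filter⁺ _ (∈-filter⁺ (¬? ∘ at-y?) z∈xs
                     (λ e′ → Unique.Unique[x∷xs]⇒x∉xs uy (subst (_∈ˡ ys) (trans (sym e) e′) y′∈))) e))
      (fib (there y′∈))
    ih = length-fibres m rest ys (Unique.filter⁺ _ ux) uys into′ fib′

  -- `σ` exchanges the two points of each fibre. It will be negation for the squaring map, on the
  -- units and on B, and inversion of pairs for the map from pairs to blocks.
  length-two-to-one : (σ : A → A) (xs : List A) (ys : List C) → Unique xs → Unique ys →
    (∀ {x} → x ∈ˡ xs → f x ∈ˡ ys) →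
    (∀ {y} → y ∈ˡ ys → ∃ λ x → x ∈ˡ xs × f x ≡ y) →
    (∀ {x} → x ∈ˡ xs → σ x ∈ˡ xs × f (σ x) ≡ f x × ¬ (σ x ≡ x)) →
    (∀ {x x′} → x ∈ˡ xs → x′ ∈ˡ xs → f x ≡ f x′ → x′ ≡ x ⊎ x′ ≡ σ x) →
    length xs ≡ length ys ℕ.* 2
  length-two-to-one σ xs ys ux uy into onto twin fibre =
    length-fibres 2 xs ys ux uy into fib
    where
    fib : ∀ {y} → y ∈ˡ ys → length (filter (λ x → f x ≟ y) xs) ≡ 2
    fib {y} y∈ with onto y∈
    ... | x , x∈ , refl with twin x∈
    ...   | σx∈ , fσx , σx≢x = unique-length {ys = x ∷ σ x ∷ []}
      (Unique.filter⁺ _ ux) (((λ e → σx≢x (sym e)) ∷ []) ∷ [] ∷ [])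
      (λ z∈ → let z∈xs , e = ∈-filter⁻ (λ x → f x ≟ y) {xs = xs} z∈ in pair (fibre x∈ z∈xs (sym e)))
      (λ { (here refl) → ∈-filter⁺ _ x∈ refl ; (there (here refl)) → ∈-filter⁺ _ σx∈ fσx })
      where
      pair : ∀ {z} → z ≡ x ⊎ z ≡ σ x → z ∈ˡ x ∷ σ x ∷ []
      pair (inj₁ e) = here e
      pair (inj₂ e) = there (here e)

-- Subsets as lists, ordered pairs of distinct elements, and three-element sets.

private variable n : ℕ

elements : Subset n → List (Fin n)
elements []          = []
elements (true ∷ S)  = Fin.zero ∷ List.map Fin.suc (elements S)
elements (false ∷ S) = List.map Fin.suc (elements S)

length-elements : (S : Subset n) → length (elements S) ≡ ∣ S ∣
length-elements []          = refl
length-elements (true ∷ S)  = cong suc (trans (List.length-map Fin.suc (elements S)) (length-elements S))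
length-elements (false ∷ S) = trans (List.length-map Fin.suc (elements S)) (length-elements S)

zero∉map-suc : (xs : List (Fin n)) → Fin.zero ∉ˡ List.map Fin.suc xs
zero∉map-suc xs z∈ with _ , _ , () ← ∈-map⁻ Fin.suc z∈

unique-elements : (S : Subset n) → Unique (elements S)
unique-elements []          = []
unique-elements (true ∷ S)  =
  ∉⇒unique-∷ (zero∉map-suc (elements S)) (Unique.map⁺ Fin.suc-injective (unique-elements S))
unique-elements (false ∷ S) = Unique.map⁺ Fin.suc-injective (unique-elements S)

∈⇒∈elements : {S : Subset n} {x : Fin n} → x ∈ S → x ∈ˡ elements S
∈⇒∈elements {S = true ∷ S}  here      = here refl
∈⇒∈elements {S = true ∷ S}  (there x) = there (∈-map⁺ Fin.suc (∈⇒∈elements x))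
∈⇒∈elements {S = false ∷ S} (there x) = ∈-map⁺ Fin.suc (∈⇒∈elements x)

∈elements⇒∈ : {S : Subset n} {x : Fin n} → x ∈ˡ elements S → x ∈ S
∈elements⇒∈ {S = true ∷ S}  (here refl) = here
∈elements⇒∈ {S = true ∷ S}  (there x∈) with ∈-map⁻ Fin.suc x∈
... | _ , y∈ , refl = there (∈elements⇒∈ y∈)
∈elements⇒∈ {S = false ∷ S} x∈ with ∈-map⁻ Fin.suc x∈
... | _ , y∈ , refl = there (∈elements⇒∈ y∈)

module _ (_≟_ : DecidableEquality A) where

  _without_ : List A → A → List A
  xs without x = filter (λ y → ¬? (x ≟ y)) xs

  length-without : ∀ {x xs} → Unique xs → x ∈ˡ xs → suc (length (xs without x)) ≡ length xs
  length-without {x} {xs} u x∈ = unique-length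
    (∉⇒unique-∷ (λ x∈′ → proj₂ (∈-filter⁻ (λ y → ¬? (x ≟ y)) {xs = xs} x∈′) refl) (Unique.filter⁺ _ u)) u
    (λ { (here refl) → x∈ ; (there z∈) → proj₁ (∈-filter⁻ (λ y → ¬? (x ≟ y)) {xs = xs} z∈) }) split
    where
    split : ∀ {z} → z ∈ˡ xs → z ∈ˡ x ∷ (xs without x)
    split {z} z∈ with x ≟ z
    ... | yes refl = here refl
    ... | no x≢z   = there (∈-filter⁺ _ z∈ x≢z)

  distinct? : (x : A × A) → Dec (¬ proj₁ x ≡ proj₂ x)
  distinct? (x , y) = ¬? (x ≟ y)

  distinctPairs : List A → List (A × A)
  distinctPairs xs = filter distinct? (cartesianProduct xs xs)

  unique-distinctPairs : ∀ {xs} → Unique xs → Unique (distinctPairs xs)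
  unique-distinctPairs u = Unique.filter⁺ distinct? (Unique.cartesianProduct⁺ u u)

  ∈-distinctPairs⁺ : ∀ {xs x y} → x ∈ˡ xs → y ∈ˡ xs → ¬ x ≡ y → (x , y) ∈ˡ distinctPairs xs
  ∈-distinctPairs⁺ x∈ y∈ x≢y = ∈-filter⁺ distinct? (∈-cartesianProduct⁺ x∈ y∈) x≢y

  ∈-distinctPairs⁻ : ∀ xs {x y} → (x , y) ∈ˡ distinctPairs xs → x ∈ˡ xs × y ∈ˡ xs × ¬ x ≡ y
  ∈-distinctPairs⁻ xs xy∈ with xy∈′ , x≢y ← ∈-filter⁻ distinct? {xs = cartesianProduct xs xs} xy∈
    with x∈ , y∈ ← ∈-cartesianProduct⁻ xs xs xy∈′ = x∈ , y∈ , x≢y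

  -- The first projection has fibres of size m: over x lie the pairs whose second entry is one of
  -- the other elements.
  length-distinctPairs : ∀ m {xs} → Unique xs → length xs ≡ suc m → length (distinctPairs xs) ≡ suc m ℕ.* m
  length-distinctPairs m {xs} u len = trans
    (length-fibres _≟_ proj₁ m (distinctPairs xs) xs (unique-distinctPairs u) u
      (λ xy∈ → proj₁ (∈-distinctPairs⁻ xs xy∈)) fibre)
    (cong (ℕ._* m) len)
    where
    fibre : ∀ {x} → x ∈ˡ xs → length (filter (λ z → proj₁ z ≟ x) (distinctPairs xs)) ≡ m
    fibre {x} x∈ = trans
      (unique-length (Unique.filter⁺ _ (unique-distinctPairs u))
        (Unique.map⁺ {f = x ,_} Product.,-injectiveʳ (Unique.filter⁺ _ u)) fwd bwd)
      (trans (List.length-map (x ,_) (xs without x)) (ℕ.suc-injective (trans (length-without u x∈) len)))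
      where
      fwd : ∀ {z} → z ∈ˡ filter (λ z → proj₁ z ≟ x) (distinctPairs xs) → z ∈ˡ List.map (x ,_) (xs without x)
      fwd z∈ with z∈′ , refl ← ∈-filter⁻ (λ z → proj₁ z ≟ x) {xs = distinctPairs xs} z∈
        with _ , y∈ , x≢y ← ∈-distinctPairs⁻ xs z∈′ = ∈-map⁺ (x ,_) (∈-filter⁺ _ y∈ x≢y)
      bwd : ∀ {z} → z ∈ˡ List.map (x ,_) (xs without x) → z ∈ˡ filter (λ z → proj₁ z ≟ x) (distinctPairs xs)
      bwd z∈ with y , y∈ , refl ← ∈-map⁻ (x ,_) z∈ with y∈′ , x≢y ← ∈-filter⁻ (λ y → ¬? (x ≟ y)) {xs = xs} y∈ =
        ∈-filter⁺ _ (∈-distinctPairs⁺ x∈ y∈′ x≢y) refl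

module _ {v : ℕ} where

  triple : (P Q R : Fin v) → Subset v
  triple P Q R = ⁅ P ⁆ ∪ (⁅ Q ⁆ ∪ ⁅ R ⁆)

  ∈triple⁺ : ∀ {P Q R x} → x ∈ˡ P ∷ Q ∷ R ∷ [] → x ∈ triple P Q R
  ∈triple⁺ (here refl)                 = x∈p∪q⁺ (inj₁ (x∈⁅x⁆ _))
  ∈triple⁺ (there (here refl))         = x∈p∪q⁺ (inj₂ (x∈p∪q⁺ (inj₁ (x∈⁅x⁆ _))))
  ∈triple⁺ (there (there (here refl))) = x∈p∪q⁺ (inj₂ (x∈p∪q⁺ (inj₂ (x∈⁅x⁆ _))))

  ∈triple⁻ : ∀ {P Q R x} → x ∈ triple P Q R → x ∈ˡ P ∷ Q ∷ R ∷ []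
  ∈triple⁻ {P} {Q} {R} x∈ with x∈p∪q⁻ ⁅ P ⁆ (⁅ Q ⁆ ∪ ⁅ R ⁆) x∈
  ... | inj₁ x∈P = here (x∈⁅y⁆⇒x≡y P x∈P)
  ... | inj₂ x∈′ with x∈p∪q⁻ ⁅ Q ⁆ ⁅ R ⁆ x∈′
  ...   | inj₁ x∈Q = there (here (x∈⁅y⁆⇒x≡y Q x∈Q))
  ...   | inj₂ x∈R = there (there (here (x∈⁅y⁆⇒x≡y R x∈R)))

  ∣triple∣ : ∀ {P Q R} → Unique (P ∷ Q ∷ R ∷ []) → ∣ triple P Q R ∣ ≡ 3
  ∣triple∣ {P} {Q} {R} u = trans (sym (length-elements (triple P Q R)))
    (unique-length (unique-elements (triple P Q R)) u (∈triple⁻ ∘ ∈elements⇒∈) (∈⇒∈elements ∘ ∈triple⁺))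

  size-3 : (T : Subset v) → ∣ T ∣ ≡ 3 → ∃ λ P → ∃ λ Q → ∃ λ R →
    Unique (P ∷ Q ∷ R ∷ []) × (∀ {x} → x ∈ˡ P ∷ Q ∷ R ∷ [] → x ∈ T) × (∀ {x} → x ∈ T → x ∈ˡ P ∷ Q ∷ R ∷ [])
  -- The list and every fact about it are abstracted together, so that matching on its shape
  -- specialises all of them to P, Q, R.
  size-3 T ∣T∣≡3 with elements T | unique-elements T | trans (length-elements T) ∣T∣≡3
                    | (λ {x} → ∈elements⇒∈ {S = T} {x}) | (λ {x} → ∈⇒∈elements {S = T} {x})
  ... | P ∷ Q ∷ R ∷ [] | u | refl | from | to = P , Q , R , u , from , to

-- Field arithmetic, a ring solver with integer coefficients, and the characteristic.

module Field {q : ℕ} (F : FiniteField q) where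
  open FiniteField F public

  F-ring : CommutativeRing 0ℓ 0ℓ
  F-ring = record { isCommutativeRing = isCommutativeRing }

  open CommutativeRing F-ring public
    using (+-comm; +-assoc; *-comm; *-assoc; +-identityˡ; +-identityʳ; *-identityˡ; *-identityʳ;
           zeroˡ; zeroʳ; -‿inverseˡ; -‿inverseʳ)
  open Exp (CommutativeRing.commutativeSemiring F-ring) public
    using (_^_; ^-homo-*; ^-assocʳ; ^-distrib-*)
  open Mult (CommutativeRing.semiring F-ring) using (×-homo-+; ×1-homo-*; 1+×)
    renaming (_×_ to _⋆_)
  private
    module U = UnoptimisedMult (CommutativeRing.semiring F-ring)
  open RingProperties (CommutativeRing.ring F-ring) public
    using (-‿distribˡ-*; -‿distribʳ-*; -0#≈0#; -‿involutive)
  open AbelianGroupProperties (CommutativeRing.+-abelianGroup F-ring)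
    using () renaming (⁻¹-∙-comm to -‿+-comm)

  private
    ⟦_⟧ : ℤ → Fin q
    ⟦ pos n ⟧      = n ⋆ 1#
    ⟦ -[1+ n ] ⟧ = - (suc n ⋆ 1#)

    cancel-1 : ∀ x y → x - y ≡ (1# + x) - (1# + y)
    cancel-1 x y = sym (begin
      (1# + x) + - (1# + y)     ≡⟨ cong ((1# + x) +_) (-‿+-comm 1# y) ⟨
      (1# + x) + (- 1# + - y)   ≡⟨ cong (_+ (- 1# + - y)) (+-comm 1# x) ⟩
      (x + 1#) + (- 1# + - y)   ≡⟨ +-assoc x 1# _ ⟩
      x + (1# + (- 1# + - y))   ≡⟨ cong (x +_) (+-assoc 1# _ _) ⟨
      x + ((1# + - 1#) + - y)   ≡⟨ cong (λ z → x + (z + - y)) (-‿inverseʳ 1#) ⟩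
      x + (0# + - y)            ≡⟨ cong (x +_) (+-identityˡ _) ⟩
      x - y                     ∎)
      where open ≡-Reasoning

    ⊖-homo : ∀ m n → ⟦ m ⊖ n ⟧ ≡ (m ⋆ 1#) - (n ⋆ 1#)
    ⊖-homo m zero = sym (trans (cong ((m ⋆ 1#) +_) -0#≈0#) (+-identityʳ (m ⋆ 1#)))
    ⊖-homo zero (suc n) = sym (+-identityˡ _)
    ⊖-homo (suc m) (suc n) =
      trans (cong ⟦_⟧ (ℤ.[1+m]⊖[1+n]≡m⊖n m n)) (trans (⊖-homo m n) (trans (cancel-1 _ _)
        (sym (cong₂ _-_ (1+× m 1#) (1+× n 1#)))))

    +-homo : ∀ i j → ⟦ i ℤ.+ j ⟧ ≡ ⟦ i ⟧ + ⟦ j ⟧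
    +-homo (pos m)    (pos n)    = ×-homo-+ 1# m n
    +-homo (pos m)    -[1+ n ] = ⊖-homo m (suc n)
    +-homo -[1+ m ] (pos n)    = trans (⊖-homo n (suc m)) (+-comm _ _)
    +-homo -[1+ m ] -[1+ n ] = begin
      - (suc (suc (m ℕ.+ n)) ⋆ 1#)        ≡⟨ cong (λ l → - (suc l ⋆ 1#)) (ℕ.+-suc m n) ⟨
      - ((suc m ℕ.+ suc n) ⋆ 1#)          ≡⟨ cong -_ (×-homo-+ 1# (suc m) (suc n)) ⟩
      - (suc m ⋆ 1# + suc n ⋆ 1#)         ≡⟨ -‿+-comm _ _ ⟨
      - (suc m ⋆ 1#) + - (suc n ⋆ 1#)     ∎
      where open ≡-Reasoning

    -‿homo : ∀ i → ⟦ ℤ.- i ⟧ ≡ - ⟦ i ⟧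
    -‿homo (pos zero)  = sym -0#≈0#
    -‿homo (pos (suc n)) = refl
    -‿homo -[1+ n ]  = sym (-‿involutive _)

    *-homo⁺ : ∀ m j → ⟦ pos m ℤ.* j ⟧ ≡ ⟦ pos m ⟧ * ⟦ j ⟧
    *-homo⁺ m (pos n) = trans (cong ⟦_⟧ (sym (ℤ.pos-* m n))) (×1-homo-* m n)
    *-homo⁺ m -[1+ n ] = begin
      ⟦ pos m ℤ.* ℤ.- (pos (suc n)) ⟧    ≡⟨ cong ⟦_⟧ (ℤ.neg-distribʳ-* (pos m) (pos (suc n))) ⟨
      ⟦ ℤ.- (pos m ℤ.* pos (suc n)) ⟧    ≡⟨ -‿homo (pos m ℤ.* pos (suc n)) ⟩
      - ⟦ pos m ℤ.* pos (suc n) ⟧        ≡⟨ cong -_ (*-homo⁺ m (pos (suc n))) ⟩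
      - (⟦ pos m ⟧ * ⟦ pos (suc n) ⟧)    ≡⟨ -‿distribʳ-* _ _ ⟩
      ⟦ pos m ⟧ * - ⟦ pos (suc n) ⟧      ∎
      where open ≡-Reasoning

    *-homo : ∀ i j → ⟦ i ℤ.* j ⟧ ≡ ⟦ i ⟧ * ⟦ j ⟧
    *-homo (pos m)  j = *-homo⁺ m j
    *-homo -[1+ m ] j = begin
      ⟦ ℤ.- (pos (suc m)) ℤ.* j ⟧      ≡⟨ cong ⟦_⟧ (ℤ.neg-distribˡ-* (pos (suc m)) j) ⟨
      ⟦ ℤ.- (pos (suc m) ℤ.* j) ⟧      ≡⟨ -‿homo (pos (suc m) ℤ.* j) ⟩
      - ⟦ pos (suc m) ℤ.* j ⟧          ≡⟨ cong -_ (*-homo⁺ (suc m) j) ⟩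
      - (⟦ pos (suc m) ⟧ * ⟦ j ⟧)      ≡⟨ -‿distribˡ-* _ _ ⟩
      - ⟦ pos (suc m) ⟧ * ⟦ j ⟧        ∎
      where open ≡-Reasoning

    ℤ⟶F : CommutativeRing.rawRing ℤ.+-*-commutativeRing -Raw-AlmostCommutative⟶ fromCommutativeRing F-ring
    ℤ⟶F = record
      { ⟦_⟧ = ⟦_⟧ ; +-homo = +-homo ; *-homo = *-homo ; -‿homo = -‿homo
      ; 0-homo = refl ; 1-homo = refl }

  -- The carrier's own operations do not compute, so the solver takes its coefficients in ℤ.
  private
    module RS = RingSolver _ (fromCommutativeRing F-ring) ℤ⟶F
      (λ i j → Maybe.map (cong ⟦_⟧) (dec⇒weaklyDec ℤ._≟_ i j))
  open RS public using (solve; _:+_; _:*_; _:-_; :-_; _:=_; con)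

  :1 : ∀ {n} → RS.Polynomial n
  :1 = con (pos 1)

  :0 : ∀ {n} → RS.Polynomial n
  :0 = con (pos 0)

  module _ where
    open ≡-Reasoning

    1≢0 : ¬ 1# ≡ 0#
    1≢0 = 0≢1 ∘ sym

    inverseˡ : ∀ {x} → ¬ x ≡ 0# → inv x * x ≡ 1#
    inverseˡ x≢0 = trans (*-comm _ _) (inverse _ x≢0)

    inv*-cancel : ∀ {x} y → ¬ x ≡ 0# → inv x * (x * y) ≡ y
    inv*-cancel {x} y x≢0 = begin
      inv x * (x * y)  ≡⟨ *-assoc _ _ _ ⟨
      (inv x * x) * y  ≡⟨ cong (_* y) (inverseˡ x≢0) ⟩
      1# * y           ≡⟨ *-identityˡ y ⟩
      y                ∎

    *inv-cancel : ∀ {x} y → ¬ x ≡ 0# → x * (inv x * y) ≡ y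
    *inv-cancel {x} y x≢0 = begin
      x * (inv x * y)  ≡⟨ *-assoc _ _ _ ⟨
      (x * inv x) * y  ≡⟨ cong (_* y) (inverse _ x≢0) ⟩
      1# * y           ≡⟨ *-identityˡ y ⟩
      y                ∎

    *-cancelˡ : ∀ {x y z} → ¬ x ≡ 0# → x * y ≡ x * z → y ≡ z
    *-cancelˡ {x} {y} {z} x≢0 eq = begin
      y                ≡⟨ inv*-cancel y x≢0 ⟨
      inv x * (x * y)  ≡⟨ cong (inv x *_) eq ⟩
      inv x * (x * z)  ≡⟨ inv*-cancel z x≢0 ⟩
      z                ∎

    *-cancel-0ˡ : ∀ {x y} → ¬ x ≡ 0# → x * y ≡ 0# → y ≡ 0#
    *-cancel-0ˡ {x} x≢0 eq = *-cancelˡ x≢0 (trans eq (sym (zeroʳ x)))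

    zero-product : ∀ {x y} → x * y ≡ 0# → x ≡ 0# ⊎ y ≡ 0#
    zero-product {x} eq with x Fin.≟ 0#
    ... | yes x≡0 = inj₁ x≡0
    ... | no x≢0  = inj₂ (*-cancel-0ˡ x≢0 eq)

    *-nonzero : ∀ {x y} → ¬ x ≡ 0# → ¬ y ≡ 0# → ¬ x * y ≡ 0#
    *-nonzero x≢0 y≢0 eq = y≢0 (*-cancel-0ˡ x≢0 eq)

    nonzeroˡ : ∀ {x y} → ¬ x * y ≡ 0# → ¬ x ≡ 0#
    nonzeroˡ {y = y} xy≢0 refl = xy≢0 (zeroˡ y)

    nonzeroʳ : ∀ {x y} → ¬ x * y ≡ 0# → ¬ y ≡ 0#
    nonzeroʳ {x} xy≢0 refl = xy≢0 (zeroʳ x)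

    inv-nonzero : ∀ {x} → ¬ x ≡ 0# → ¬ inv x ≡ 0#
    inv-nonzero {x} x≢0 = nonzeroʳ {x} (subst (λ z → ¬ z ≡ 0#) (sym (inverse x x≢0)) 1≢0)

    ^-nonzero : ∀ {x} n → ¬ x ≡ 0# → ¬ x ^ n ≡ 0#
    ^-nonzero zero    x≢0 = 1≢0
    ^-nonzero (suc n) x≢0 = *-nonzero x≢0 (^-nonzero n x≢0)

    1^ : ∀ n → 1# ^ n ≡ 1#
    1^ zero    = refl
    1^ (suc n) = trans (*-identityˡ _) (1^ n)

    x-y≡0⇒x≡y : ∀ {x y} → x - y ≡ 0# → x ≡ y
    x-y≡0⇒x≡y {x} {y} eq = begin
      x            ≡⟨ solve 2 (λ x y → x := y :+ (x :- y)) refl x y ⟩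
      y + (x - y)  ≡⟨ cong (y +_) eq ⟩
      y + 0#       ≡⟨ +-identityʳ y ⟩
      y            ∎

    x≡y⇒x-y≡0 : ∀ {x y} → x ≡ y → x - y ≡ 0#
    x≡y⇒x-y≡0 {x} refl = -‿inverseʳ x

    -‿nonzero : ∀ {x} → ¬ x ≡ 0# → ¬ - x ≡ 0#
    -‿nonzero {x} x≢0 eq = x≢0 (trans (sym (-‿involutive x)) (trans (cong -_ eq) -0#≈0#))

    -- `_·1` recurses like the unoptimised multiple, whereas the solver interprets integers by the
    -- optimised one. This bridge transfers the additive and multiplicative laws.
    ·1≡×1 : ∀ n → n ·1 ≡ U._×_ n 1#
    ·1≡×1 zero    = refl
    ·1≡×1 (suc n) = cong (1# +_) (·1≡×1 n)

    ·1-+ : ∀ m n → (m ℕ.+ n) ·1 ≡ m ·1 + n ·1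
    ·1-+ m n = begin
      (m ℕ.+ n) ·1                ≡⟨ ·1≡×1 (m ℕ.+ n) ⟩
      U._×_ (m ℕ.+ n) 1#          ≡⟨ U.×-homo-+ 1# m n ⟩
      U._×_ m 1# + U._×_ n 1#     ≡⟨ cong₂ _+_ (·1≡×1 m) (·1≡×1 n) ⟨
      m ·1 + n ·1                 ∎

    ·1-* : ∀ m n → (m ℕ.* n) ·1 ≡ m ·1 * n ·1
    ·1-* m n = begin
      (m ℕ.* n) ·1                ≡⟨ ·1≡×1 (m ℕ.* n) ⟩
      U._×_ (m ℕ.* n) 1#          ≡⟨ U.×1-homo-* m n ⟩
      U._×_ m 1# * U._×_ n 1#     ≡⟨ cong₂ _*_ (·1≡×1 m) (·1≡×1 n) ⟨
      m ·1 * n ·1                 ∎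

    -- Since 0 < m < p and p is prime, Bézout writes 1 as a difference of a multiple of m and a
    -- multiple of p. Both multiples would be zero in the field.
    ·1-nonzero : ∀ {p} → HasCharacteristic F p → ∀ m → .{{ℕ.NonZero m}} → m ℕ.< p → ¬ m ·1 ≡ 0#
    ·1-nonzero {p} (p-prime , p1) m m<p m1 = 0≢1 (sym (absurd (coprime-Bézout (prime⇒coprime p-prime m<p))))
      where
      vanish : ∀ y n → n ·1 ≡ 0# → (y ℕ.* n) ·1 ≡ 0#
      vanish y n e = trans (·1-* y n) (trans (cong (y ·1 *_) e) (zeroʳ _))
      absurd : Bézout.Identity 1 p m → 1# ≡ 0#
      absurd (Bézout.+- x y eq) = begin
        1#                          ≡⟨ +-identityʳ 1# ⟨
        1# + 0#                     ≡⟨ cong (1# +_) (vanish y m m1) ⟨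
        1# + (y ℕ.* m) ·1           ≡⟨ cong _·1 eq ⟩
        (x ℕ.* p) ·1                ≡⟨ vanish x p p1 ⟩
        0#                          ∎
      absurd (Bézout.-+ x y eq) = begin
        1#                          ≡⟨ +-identityʳ 1# ⟨
        1# + 0#                     ≡⟨ cong (1# +_) (vanish x p p1) ⟨
        1# + (x ℕ.* p) ·1           ≡⟨ cong _·1 eq ⟩
        (y ℕ.* m) ·1                ≡⟨ vanish y m m1 ⟩
        0#                          ∎

  -- Polynomials: root counting and comparison of k-th powers of linear forms.

  module _ where
    open ≡-Reasoning

    -- Coefficient vectors list the constant term first.
    eval : ∀ {n} → Vec (Fin q) n → Fin q → Fin q
    eval []       x = 0#
    eval (c ∷ cs) x = c + x * eval cs x

    -- Synthetic division: the values of the suffixes at `r` are Horner's partial results. For the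
    -- polynomial P with coefficients `c ∷ cs`, `quotient r cs` is (P(x) - P(r)) / (x - r), whose
    -- length is that of `cs`.
    quotient : ∀ {n} → Fin q → Vec (Fin q) n → Vec (Fin q) n
    quotient r []       = []
    quotient r (c ∷ cs) = eval (c ∷ cs) r ∷ quotient r cs

    eval-quotient : ∀ {n} r (cs : Vec (Fin q) n) x →
      x * eval cs x - r * eval cs r ≡ (x - r) * eval (quotient r cs) x
    eval-quotient r []       x = solve 2 (λ x r → x :* :0 :- r :* :0 := (x :- r) :* :0) refl x r
    eval-quotient r (c ∷ cs) x = begin
      x * (c + x * E) - r * (c + r * D)
        ≡⟨ solve 5 (λ x r c E D → x :* (c :+ x :* E) :- r :* (c :+ r :* D)
                    := (x :- r) :* (c :+ r :* D) :+ x :* (x :* E :- r :* D)) refl x r c E D ⟩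
      (x - r) * (c + r * D) + x * (x * E - r * D)
        ≡⟨ cong (λ z → (x - r) * (c + r * D) + x * z) (eval-quotient r cs x) ⟩
      (x - r) * (c + r * D) + x * ((x - r) * Q)
        ≡⟨ solve 4 (λ x r C Q → (x :- r) :* C :+ x :* ((x :- r) :* Q)
                    := (x :- r) :* (C :+ x :* Q)) refl x r (c + r * D) Q ⟩
      (x - r) * (c + r * D + x * Q)   ∎
      where
      E = eval cs x
      D = eval cs r
      Q = eval (quotient r cs) x

    eval-0 : ∀ n x → eval (replicate n 0#) x ≡ 0#
    eval-0 zero    x = refl
    eval-0 (suc n) x = trans (+-identityˡ _) (trans (cong (x *_) (eval-0 n x)) (zeroʳ x))

    -- The entries of the quotient are the values at `r` of the suffixes of `cs`. Read from the end,
    -- each suffix brings in one new coefficient, which must then vanish.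
    quotient-0 : ∀ {n} r (cs : Vec (Fin q) n) → quotient r cs ≡ replicate n 0# → cs ≡ replicate n 0#
    quotient-0 r [] _ = refl
    quotient-0 {suc n} r (c ∷ cs) eq = cong₂ _∷_ c≡0 cs≡0
      where
      cs≡0 = quotient-0 r cs (Vec.∷-injectiveʳ eq)
      c≡0 = begin
        c                   ≡⟨ +-identityʳ c ⟨
        c + 0#              ≡⟨ cong (c +_) (zeroʳ r) ⟨
        c + r * 0#          ≡⟨ cong (λ z → c + r * z) (eval-0 n r) ⟨
        c + r * eval (replicate n 0#) r ≡⟨ cong (λ z → c + r * eval z r) cs≡0 ⟨
        c + r * eval cs r   ≡⟨ Vec.∷-injectiveˡ eq ⟩
        0#                  ∎

    -- Dividing by x - r leaves a quotient that vanishes at the remaining roots, hence is zero by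
    -- induction. Only the constant term is left, and the root `r` kills it.
    many-roots⇒0 : ∀ {n} (cs : Vec (Fin q) n) (rs : List (Fin q)) → Unique rs → n ℕ.≤ length rs →
      (∀ {r} → r ∈ˡ rs → eval cs r ≡ 0#) → cs ≡ replicate n 0#
    many-roots⇒0 [] rs _ _ _ = refl
    many-roots⇒0 {suc n} (c ∷ cs) (r ∷ rs) u@(_ ∷ us) (ℕ.s≤s le) root = cong₂ _∷_ c≡0 cs≡0
      where
      root-quotient : ∀ {x} → x ∈ˡ rs → eval (quotient r cs) x ≡ 0#
      root-quotient {x} x∈ = *-cancel-0ˡ {x - r} x-r≢0 (begin
        (x - r) * eval (quotient r cs) x     ≡⟨ eval-quotient r cs x ⟨
        x * eval cs x - r * eval cs r        ≡⟨ solve 3 (λ c a b → a :- b := (c :+ a) :- (c :+ b)) refl c _ _ ⟩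
        eval (c ∷ cs) x - eval (c ∷ cs) r    ≡⟨ cong₂ _-_ (root (there x∈)) (root (here refl)) ⟩
        0# - 0#                              ≡⟨ -‿inverseʳ 0# ⟩
        0#                                   ∎)
        where
        x-r≢0 : ¬ x - r ≡ 0#
        x-r≢0 e = Unique.Unique[x∷xs]⇒x∉xs u (subst (_∈ˡ rs) (x-y≡0⇒x≡y e) x∈)
      cs≡0 : cs ≡ replicate n 0#
      cs≡0 = quotient-0 r cs (many-roots⇒0 (quotient r cs) rs us le root-quotient)
      c≡0 : c ≡ 0#
      c≡0 = begin
        c                   ≡⟨ +-identityʳ c ⟨
        c + 0#              ≡⟨ cong (c +_) (zeroʳ r) ⟨
        c + r * 0#          ≡⟨ cong (λ z → c + r * z) (eval-0 n r) ⟨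
        c + r * eval (replicate n 0#) r ≡⟨ cong (λ z → c + r * eval z r) cs≡0 ⟨
        c + r * eval cs r   ≡⟨ root (here refl) ⟩
        0#                  ∎

    monomial : ∀ n → Vec (Fin q) (suc n)
    monomial zero    = 1# ∷ []
    monomial (suc n) = 0# ∷ monomial n

    eval-monomial : ∀ n x → eval (monomial n) x ≡ x ^ n
    eval-monomial zero    x = solve 1 (λ x → :1 :+ x :* :0 := :1) refl x
    eval-monomial (suc n) x = trans (+-identityˡ _) (cong (x *_) (eval-monomial n x))

    -- The polynomial x^m - 1 has m + 1 coefficients, so m + 1 roots would force its constant term
    -- -1 to be zero.
    roots-of-unity-≤ : ∀ m .{{_ : ℕ.NonZero m}} (rs : List (Fin q)) → Unique rs →
      (∀ {r} → r ∈ˡ rs → r ^ m ≡ 1#) → length rs ℕ.≤ m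
    roots-of-unity-≤ (suc m) rs u root with length rs ℕ.≤? suc m
    ... | yes le = le
    ... | no ¬le = contradiction (Vec.∷-injectiveˡ all-0) (-‿nonzero 1≢0)
      where
      all-0 = many-roots⇒0 (- 1# ∷ monomial m) rs u (ℕ.≰⇒> ¬le) λ {r} r∈ → begin
        - 1# + r * eval (monomial m) r  ≡⟨ cong (λ z → - 1# + r * z) (eval-monomial m r) ⟩
        - 1# + r ^ suc m                ≡⟨ cong (- 1# +_) (root r∈) ⟩
        - 1# + 1#                       ≡⟨ -‿inverseˡ 1# ⟩
        0#                              ∎

    -- (b + a x) times cs, plus the constant a prev.
    mulLinear : ∀ {n} (a b prev : Fin q) → Vec (Fin q) n → Vec (Fin q) (suc n)
    mulLinear a b prev []       = a * prev ∷ []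
    mulLinear a b prev (c ∷ cs) = (b * c + a * prev) ∷ mulLinear a b c cs

    eval-mulLinear : ∀ {n} a b prev (cs : Vec (Fin q) n) x →
      eval (mulLinear a b prev cs) x ≡ (a * x + b) * eval cs x + a * prev
    eval-mulLinear a b prev []       x =
      solve 4 (λ a b p x → a :* p :+ x :* :0 := (a :* x :+ b) :* :0 :+ a :* p) refl a b prev x
    eval-mulLinear a b prev (c ∷ cs) x = trans
      (cong (λ z → (b * c + a * prev) + x * z) (eval-mulLinear a b c cs x))
      (solve 6 (λ a b p x c E → (b :* c :+ a :* p) :+ x :* ((a :* x :+ b) :* E :+ a :* c)
                := (a :* x :+ b) :* (c :+ x :* E) :+ a :* p) refl a b prev x c (eval cs x))

    linearPower : (a b : Fin q) (n : ℕ) → Vec (Fin q) (suc n)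
    linearPower a b zero    = 1# ∷ []
    linearPower a b (suc n) = mulLinear a b 0# (linearPower a b n)

    eval-linearPower : ∀ a b n x → eval (linearPower a b n) x ≡ (a * x + b) ^ n
    eval-linearPower a b zero    x = eval-monomial zero x
    eval-linearPower a b (suc n) x = begin
      eval (mulLinear a b 0# (linearPower a b n)) x            ≡⟨ eval-mulLinear a b 0# (linearPower a b n) x ⟩
      (a * x + b) * eval (linearPower a b n) x + a * 0#        ≡⟨ cong₂ _+_ (cong ((a * x + b) *_) (eval-linearPower a b n x)) (zeroʳ a) ⟩
      (a * x + b) ^ suc n + 0#                                 ≡⟨ +-identityʳ _ ⟩
      (a * x + b) ^ suc n                                      ∎

    -- The binomial coefficient C(n + 2, 2).
    triangle : ℕ → ℕ
    triangle zero    = 1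
    triangle (suc n) = (2 ℕ.+ n) ℕ.+ triangle n

    2*triangle : ∀ n → 2 ℕ.* triangle n ≡ (2 ℕ.+ n) ℕ.* (1 ℕ.+ n)
    2*triangle zero    = refl
    2*triangle (suc n) = begin
      2 ℕ.* ((2 ℕ.+ n) ℕ.+ triangle n)              ≡⟨ ℕ.*-distribˡ-+ 2 (2 ℕ.+ n) (triangle n) ⟩
      2 ℕ.* (2 ℕ.+ n) ℕ.+ 2 ℕ.* triangle n          ≡⟨ cong (2 ℕ.* (2 ℕ.+ n) ℕ.+_) (2*triangle n) ⟩
      2 ℕ.* (2 ℕ.+ n) ℕ.+ (2 ℕ.+ n) ℕ.* (1 ℕ.+ n)   ≡⟨ N.solve 1 (λ n → N.con 2 N.:* (N.con 2 N.:+ n) N.:+ (N.con 2 N.:+ n) N.:* (N.con 1 N.:+ n) N.:= (N.con 3 N.:+ n) N.:* (N.con 2 N.:+ n)) refl n ⟩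
      (3 ℕ.+ n) ℕ.* (2 ℕ.+ n)                       ∎
      where module N = +-*-Solver

    -- The binomial theorem up to x², with `triangle n` as C(n + 2, 2); higher coefficients are
    -- never inspected. The inductive step is Pascal's rule.
    linearPower-low : ∀ a b n → ∃ λ (rest : Vec (Fin q) n) → linearPower a b (2 ℕ.+ n) ≡
      b ^ (2 ℕ.+ n) ∷ (2 ℕ.+ n) ·1 * (a * b ^ (1 ℕ.+ n)) ∷ triangle n ·1 * (a * a * b ^ n) ∷ rest
    linearPower-low a b zero = [] , cong₂ _∷_
      (solve 2 (λ a b → b :* (b :* :1 :+ a :* :0) :+ a :* :0 := b :* (b :* :1)) refl a b)
      (cong₂ _∷_
        (solve 2 (λ a b → b :* (a :* :1) :+ a :* (b :* :1 :+ a :* :0)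
                  := (:1 :+ (:1 :+ :0)) :* (a :* (b :* :1))) refl a b)
        (cong (_∷ []) (solve 1 (λ a → a :* (a :* :1) := (:1 :+ :0) :* (a :* a :* :1)) refl a)))
    linearPower-low a b (suc n) with linearPower-low a b n
    ... | rest , eq = _ , trans (cong (mulLinear a b 0#) eq) (cong₂ _∷_
      (solve 3 (λ a b X → b :* X :+ a :* :0 := b :* X) refl a b (b ^ (2 ℕ.+ n)))
      (cong₂ _∷_
        (solve 4 (λ a b X m → b :* (m :* (a :* X)) :+ a :* (b :* X) := (:1 :+ m) :* (a :* (b :* X)))
          refl a b (b ^ (1 ℕ.+ n)) ((2 ℕ.+ n) ·1))
        (cong₂ _∷_ (trans
          (solve 5 (λ a b X m t → b :* (t :* (a :* a :* X)) :+ a :* (m :* (a :* (b :* X)))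
                    := (m :+ t) :* (a :* a :* (b :* X)))
            refl a b (b ^ n) ((2 ℕ.+ n) ·1) (triangle n ·1))
          (cong (_* (a * a * b ^ suc n)) (sym (·1-+ (2 ℕ.+ n) (triangle n))))) refl)))

    eval-∷ʳ : ∀ {n} (cs : Vec (Fin q) n) c x → eval (cs ∷ʳ c) x ≡ eval cs x + x ^ n * c
    eval-∷ʳ []        c x = solve 2 (λ c x → c :+ x :* :0 := :0 :+ :1 :* c) refl c x
    eval-∷ʳ {suc n} (c′ ∷ cs) c x = trans (cong (λ z → c′ + x * z) (eval-∷ʳ cs c x))
      (solve 5 (λ c′ c x E X → c′ :+ x :* (E :+ X :* c) := c′ :+ x :* E :+ x :* X :* c)
        refl c′ c x (eval cs x) (x ^ n))

    eval-zipWith-- : ∀ {n} (cs ds : Vec (Fin q) n) x → eval (zipWith _-_ cs ds) x ≡ eval cs x - eval ds x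
    eval-zipWith-- []       []       x = sym (-‿inverseʳ 0#)
    eval-zipWith-- (c ∷ cs) (d ∷ ds) x = trans (cong (λ z → (c - d) + x * z) (eval-zipWith-- cs ds x))
      (solve 5 (λ c d x E D → (c :- d) :+ x :* (E :- D) := (c :+ x :* E) :- (d :+ x :* D))
        refl c d x (eval cs x) (eval ds x))

    -- Modulo x ^ (3 + n) = 1, the top coefficient of the difference of the two
    -- powers folds onto the constant term, leaving 3 + n coefficients and
    -- 3 + n roots; the linear and the quadratic coefficients must vanish.
    agreeing-powers : ∀ n (rs : List (Fin q)) a b c d → Unique rs → 3 ℕ.+ n ℕ.≤ length rs →
      (∀ {r} → r ∈ˡ rs → r ^ (3 ℕ.+ n) ≡ 1#) →
      (∀ {r} → r ∈ˡ rs → (a * r + b) ^ (3 ℕ.+ n) ≡ (c * r + d) ^ (3 ℕ.+ n)) →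
      ¬ (3 ℕ.+ n) ·1 ≡ 0# → ¬ (2 ℕ.+ n) ·1 ≡ 0# →
      a * b ^ (2 ℕ.+ n) ≡ c * d ^ (2 ℕ.+ n) × a * a * b ^ (1 ℕ.+ n) ≡ c * c * d ^ (1 ℕ.+ n)
    agreeing-powers n rs a b c d u le root agree k≢0 k-1≢0 =
        extract k≢0 (Vec.∷-injectiveˡ (Vec.∷-injectiveʳ all-0)) ,
        extract triangle≢0 (Vec.∷-injectiveˡ (Vec.∷-injectiveʳ (Vec.∷-injectiveʳ all-0)))
      where
      k = 3 ℕ.+ n
      low₁ = linearPower-low a b (1 ℕ.+ n)
      low₂ = linearPower-low c d (1 ℕ.+ n)
      high = initLast (zipWith _-_ (proj₁ low₁) (proj₁ low₂))
      ys = proj₁ high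
      y  = proj₁ (proj₂ high)
      δ₀ = b ^ k - d ^ k
      δ₁ = k ·1 * (a * b ^ (2 ℕ.+ n)) - k ·1 * (c * d ^ (2 ℕ.+ n))
      t  = triangle (1 ℕ.+ n) ·1
      δ₂ = t * (a * a * b ^ (1 ℕ.+ n)) - t * (c * c * d ^ (1 ℕ.+ n))

      difference : zipWith _-_ (linearPower a b k) (linearPower c d k) ≡ δ₀ ∷ δ₁ ∷ δ₂ ∷ (ys ∷ʳ y)
      difference = trans (cong₂ (zipWith _-_) (proj₂ low₁) (proj₂ low₂))
        (cong (λ zs → δ₀ ∷ δ₁ ∷ δ₂ ∷ zs) (proj₂ (proj₂ high)))

      folded-root : ∀ {r} → r ∈ˡ rs → eval (δ₀ + y ∷ δ₁ ∷ δ₂ ∷ ys) r ≡ 0#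
      folded-root {r} r∈ = begin
        δ₀ + y + r * (δ₁ + r * (δ₂ + r * E))
          ≡⟨ solve 6 (λ δ₀ y r δ₁ δ₂ E → δ₀ :+ y :+ r :* (δ₁ :+ r :* (δ₂ :+ r :* E))
                      := δ₀ :+ :1 :* y :+ r :* (δ₁ :+ r :* (δ₂ :+ r :* E))) refl δ₀ y r δ₁ δ₂ E ⟩
        δ₀ + 1# * y + r * (δ₁ + r * (δ₂ + r * E))
          ≡⟨ cong (λ z → δ₀ + z * y + r * (δ₁ + r * (δ₂ + r * E))) (root r∈) ⟨
        δ₀ + r ^ k * y + r * (δ₁ + r * (δ₂ + r * E))
          ≡⟨ solve 7 (λ δ₀ y r δ₁ δ₂ E R → δ₀ :+ r :* (r :* (r :* R)) :* y :+ r :* (δ₁ :+ r :* (δ₂ :+ r :* E))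
                      := δ₀ :+ r :* (δ₁ :+ r :* (δ₂ :+ r :* (E :+ R :* y)))) refl δ₀ y r δ₁ δ₂ E (r ^ n) ⟩
        δ₀ + r * (δ₁ + r * (δ₂ + r * (E + r ^ n * y)))
          ≡⟨ cong (λ z → δ₀ + r * (δ₁ + r * (δ₂ + r * z))) (eval-∷ʳ ys y r) ⟨
        eval (δ₀ ∷ δ₁ ∷ δ₂ ∷ (ys ∷ʳ y)) r
          ≡⟨ cong (λ zs → eval zs r) difference ⟨
        eval (zipWith _-_ (linearPower a b k) (linearPower c d k)) r
          ≡⟨ eval-zipWith-- (linearPower a b k) (linearPower c d k) r ⟩
        eval (linearPower a b k) r - eval (linearPower c d k) r
          ≡⟨ cong₂ _-_ (eval-linearPower a b k r) (eval-linearPower c d k r) ⟩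
        (a * r + b) ^ k - (c * r + d) ^ k
          ≡⟨ x≡y⇒x-y≡0 (agree r∈) ⟩
        0#  ∎
        where E = eval ys r

      all-0 : δ₀ + y ∷ δ₁ ∷ δ₂ ∷ ys ≡ replicate k 0#
      all-0 = many-roots⇒0 (δ₀ + y ∷ δ₁ ∷ δ₂ ∷ ys) rs u le folded-root

      extract : ∀ {m X Y} → ¬ m ≡ 0# → m * X - m * Y ≡ 0# → X ≡ Y
      extract m≢0 e = *-cancelˡ m≢0 (x-y≡0⇒x≡y e)

      triangle≢0 : ¬ t ≡ 0#
      -- From 2 · C(k, 2) = k (k - 1): if C(k, 2) vanished in the field, so would a product of two
      -- nonzero factors.
      triangle≢0 e = *-nonzero k≢0 k-1≢0 (begin
        k ·1 * (2 ℕ.+ n) ·1                  ≡⟨ ·1-* k (2 ℕ.+ n) ⟨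
        (k ℕ.* (2 ℕ.+ n)) ·1                 ≡⟨ cong _·1 (2*triangle (1 ℕ.+ n)) ⟨
        (2 ℕ.* triangle (1 ℕ.+ n)) ·1        ≡⟨ ·1-* 2 (triangle (1 ℕ.+ n)) ⟩
        2 ·1 * t                             ≡⟨ cong (2 ·1 *_) e ⟩
        2 ·1 * 0#                            ≡⟨ zeroʳ _ ⟩
        0#                                   ∎)

    -- If no entry is zero, a² times the first equation minus ab times the second reads 0 = a c
    -- d^(n+1) (ad - bc), which is impossible. If some entry is zero, the first equation yields a
    -- second zero; two zeros in one column contradict the determinant, and the other possibilities
    -- are the two alternatives.
    diagonal-or-antidiagonal : ∀ n a b c d → ¬ a * d - b * c ≡ 0# →
      a * b ^ (2 ℕ.+ n) ≡ c * d ^ (2 ℕ.+ n) → a * a * b ^ (1 ℕ.+ n) ≡ c * c * d ^ (1 ℕ.+ n) →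
      (b ≡ 0# × c ≡ 0#) ⊎ (a ≡ 0# × d ≡ 0#)
    diagonal-or-antidiagonal n a b c d det≢0 e₁ e₂ with a Fin.≟ 0# | b Fin.≟ 0# | c Fin.≟ 0# | d Fin.≟ 0#
    ... | yes a≡0 | _ | _ | yes d≡0 = inj₂ (a≡0 , d≡0)
    ... | _ | yes b≡0 | yes c≡0 | _ = inj₁ (b≡0 , c≡0)
    ... | yes refl | _ | no c≢0 | no d≢0 =
      contradiction (trans (sym e₁) (zeroˡ _)) (*-nonzero c≢0 (^-nonzero (2 ℕ.+ n) d≢0))
    ... | yes refl | no b≢0 | yes refl | no d≢0 =
      contradiction (solve 2 (λ b d → :0 :* d :- b :* :0 := :0) refl b d) det≢0
    ... | no a≢0 | yes refl | no c≢0 | yes refl =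
      contradiction (solve 2 (λ a c → a :* :0 :- :0 :* c := :0) refl a c) det≢0
    ... | no a≢0 | yes refl | no c≢0 | no d≢0 =
      contradiction (trans (sym e₁) (trans (cong (a *_) (zeroˡ _)) (zeroʳ a))) (*-nonzero c≢0 (^-nonzero (2 ℕ.+ n) d≢0))
    ... | no a≢0 | no b≢0 | yes refl | _ =
      contradiction (trans e₁ (zeroˡ _)) (*-nonzero a≢0 (^-nonzero (2 ℕ.+ n) b≢0))
    ... | no a≢0 | no b≢0 | no c≢0 | yes refl =
      contradiction (trans e₁ (trans (cong (c *_) (zeroˡ _)) (zeroʳ c))) (*-nonzero a≢0 (^-nonzero (2 ℕ.+ n) b≢0))
    ... | no a≢0 | no b≢0 | no c≢0 | no d≢0 = contradiction
      (*-cancel-0ˡ (*-nonzero (*-nonzero a≢0 c≢0) (^-nonzero (1 ℕ.+ n) d≢0)) (begin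
        a * c * Y * (a * d - b * c)            ≡⟨ solve 5 (λ a b c d Y → a :* c :* Y :* (a :* d :- b :* c)
                                                    := a :* a :* (c :* (d :* Y)) :- a :* b :* (c :* c :* Y)) refl a b c d Y ⟩
        a * a * (c * (d * Y)) - a * b * (c * c * Y) ≡⟨ cong₂ (λ u v → a * a * u - a * b * v) e₁ e₂ ⟨
        a * a * (a * (b * X)) - a * b * (a * a * X) ≡⟨ solve 3 (λ a b X → a :* a :* (a :* (b :* X)) :- a :* b :* (a :* a :* X)
                                                    := :0) refl a b X ⟩
        0#                                     ∎))
      det≢0
      where
      X = b ^ (1 ℕ.+ n)
      Y = d ^ (1 ℕ.+ n)

-- Squares in the multiplicative group: Fermat, counting, and Euler's criterion.

module Squares {q : ℕ} (F : FiniteField q) where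
  open Field F
  open ≡-Reasoning

  prod : List (Fin q) → Fin q
  prod = foldr _*_ 1#

  prod-↭ : ∀ {xs ys} → xs ↭ ys → prod xs ≡ prod ys
  prod-↭ ↭.refl = refl
  prod-↭ (↭.prep x p) = cong (x *_) (prod-↭ p)
  prod-↭ (↭.swap {xs} {ys} x y p) = trans (cong (λ z → x * (y * z)) (prod-↭ p))
    (solve 3 (λ x y z → x :* (y :* z) := y :* (x :* z)) refl x y (prod ys))
  prod-↭ (↭.trans p p′) = trans (prod-↭ p) (prod-↭ p′)

  prod-map-* : ∀ s xs → prod (List.map (s *_) xs) ≡ s ^ length xs * prod xs
  prod-map-* s []       = sym (*-identityˡ 1#)
  prod-map-* s (x ∷ xs) = trans (cong (s * x *_) (prod-map-* s xs))
    (solve 4 (λ s x S P → s :* x :* (S :* P) := s :* S :* (x :* P)) refl s x (s ^ length xs) (prod xs))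

  prod-nonzero : ∀ xs → 0# ∉ˡ xs → ¬ prod xs ≡ 0#
  prod-nonzero []       _  = 1≢0
  prod-nonzero (x ∷ xs) 0∉ = *-nonzero (λ x≡0 → 0∉ (here (sym x≡0))) (prod-nonzero xs (0∉ ∘ there))

  -- Multiplication by s permutes H, so both lists have the same product.
  translation-invariant⇒^≡1 : ∀ H s → Unique H → 0# ∉ˡ H → ¬ s ≡ 0# →
    (∀ {x} → x ∈ˡ H → s * x ∈ˡ H) → (∀ {x} → x ∈ˡ H → inv s * x ∈ˡ H) → s ^ length H ≡ 1#
  translation-invariant⇒^≡1 H s u 0∉ s≢0 mul div = *-cancelˡ (prod-nonzero H 0∉) (begin
    prod H * s ^ length H         ≡⟨ *-comm _ _ ⟩
    s ^ length H * prod H         ≡⟨ prod-map-* s H ⟨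
    prod (List.map (s *_) H)      ≡⟨ prod-↭ (unique-↭ (Unique.map⁺ (*-cancelˡ s≢0) u) u fwd bwd) ⟩
    prod H                        ≡⟨ *-identityʳ _ ⟨
    prod H * 1#                   ∎)
    where
    fwd : ∀ {z} → z ∈ˡ List.map (s *_) H → z ∈ˡ H
    fwd z∈ with _ , x∈ , refl ← ∈-map⁻ (s *_) z∈ = mul x∈
    bwd : ∀ {z} → z ∈ˡ H → z ∈ˡ List.map (s *_) H
    bwd {z} z∈ = subst (_∈ˡ _) (*inv-cancel z s≢0) (∈-map⁺ (s *_) (div z∈))

  nonzero? : ∀ x → Dec (¬ x ≡ 0#)
  nonzero? x = ¬? (x Fin.≟ 0#)

  units : List (Fin q)
  units = filter nonzero? (allFin q)

  unique-units : Unique units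
  unique-units = Unique.filter⁺ nonzero? (Unique.allFin⁺ q)

  ∈units : ∀ {x} → ¬ x ≡ 0# → x ∈ˡ units
  ∈units x≢0 = ∈-filter⁺ nonzero? (∈-allFin _) x≢0

  units-nonzero : ∀ {x} → x ∈ˡ units → ¬ x ≡ 0#
  units-nonzero x∈ = proj₂ (∈-filter⁻ nonzero? {xs = allFin q} x∈)

  0∉units : 0# ∉ˡ units
  0∉units 0∈ = units-nonzero 0∈ refl

  length-units : suc (length units) ≡ q
  length-units = trans
    (unique-length (∉⇒unique-∷ 0∉units unique-units) (Unique.allFin⁺ q) (λ _ → ∈-allFin _) split)
    (List.length-tabulate (λ i → i))
    where
    split : ∀ {z} → z ∈ˡ allFin q → z ∈ˡ 0# ∷ units
    split {z} _ with z Fin.≟ 0#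
    ... | yes z≡0 = here z≡0
    ... | no z≢0  = there (∈units z≢0)

  fermat : ∀ {s} → ¬ s ≡ 0# → s ^ length units ≡ 1#
  fermat {s} s≢0 = translation-invariant⇒^≡1 units s unique-units 0∉units s≢0
    (λ x∈ → ∈units (*-nonzero s≢0 (units-nonzero x∈)))
    (λ x∈ → ∈units (*-nonzero (inv-nonzero s≢0) (units-nonzero x∈)))

  IsSquare : Fin q → Set
  IsSquare x = ∃ λ s → s * s ≡ x

  isSquare? : ∀ x → Dec (IsSquare x)
  isSquare? x = Fin.any? (λ s → s * s Fin.≟ x)

  squares-equal : ∀ {x y} → x * x ≡ y * y → y ≡ x ⊎ y ≡ - x
  squares-equal {x} {y} eq = Sum.map x-y≡0⇒x≡y (λ e → x-y≡0⇒x≡y (trans (cong (y +_) (-‿involutive x)) e))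
    (zero-product {y - x} {y + x} (trans
      (solve 2 (λ x y → (y :- x) :* (y :+ x) := y :* y :- x :* x) refl x y) (x≡y⇒x-y≡0 (sym eq))))

  neg-square : ∀ x → - x * - x ≡ x * x
  neg-square = solve 1 (λ x → :- x :* :- x := x :* x) refl

  square-product : ∀ {x y} → IsSquare x → IsSquare y → IsSquare (x * y)
  square-product (s , refl) (t , refl) = s * t , solve 2 (λ s t → s :* t :* (s :* t) := s :* s :* (t :* t)) refl s t

  square-quotient : ∀ {x y} → ¬ x ≡ 0# → IsSquare x → IsSquare (x * y) → IsSquare y
  square-quotient {y = y} x≢0 (s , refl) (t , eq) = inv s * t , (begin
    inv s * t * (inv s * t)            ≡⟨ solve 2 (λ i t → i :* t :* (i :* t) := i :* (i :* (t :* t))) refl (inv s) t ⟩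
    inv s * (inv s * (t * t))          ≡⟨ cong (λ z → inv s * (inv s * z)) (trans eq (*-assoc s s y)) ⟩
    inv s * (inv s * (s * (s * y)))    ≡⟨ cong (inv s *_) (inv*-cancel (s * y) s≢0) ⟩
    inv s * (s * y)                    ≡⟨ inv*-cancel y s≢0 ⟩
    y                                  ∎)
    where s≢0 = nonzeroˡ x≢0

  square^ : ∀ s m → (s * s) ^ m ≡ s ^ (m ℕ.+ m)
  square^ s m = trans (^-distrib-* s s m) (sym (^-homo-* s m m))

  module OddCharacteristic (2≢0 : ¬ 2 ·1 ≡ 0#) where

    -x≢x : ∀ {x} → ¬ x ≡ 0# → ¬ - x ≡ x
    -x≢x {x} x≢0 e = *-nonzero 2≢0 x≢0 (begin
      2 ·1 * x   ≡⟨ solve 1 (λ x → (:1 :+ (:1 :+ :0)) :* x := x :+ x) refl x ⟩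
      x + x      ≡⟨ cong (_+ x) e ⟨
      - x + x    ≡⟨ -‿inverseˡ x ⟩
      0#         ∎)

    squares nonsquares : List (Fin q)
    squares    = filter isSquare? units
    nonsquares = filter (¬? ∘ isSquare?) units

    -- Squaring on the units has the fibres {x, -x}, of size two because 2 is not zero in the field.
    length-units-squares : length units ≡ length squares ℕ.* 2
    length-units-squares = length-two-to-one Fin._≟_ (λ x → x * x) (λ x → - x) units squares unique-units
      (Unique.filter⁺ isSquare? unique-units)
      (λ {x} x∈ → ∈-filter⁺ isSquare? (∈units (*-nonzero (units-nonzero x∈) (units-nonzero x∈))) (x , refl))
      (λ y∈ → root (∈-filter⁻ isSquare? {xs = units} y∈))
      (λ {x} x∈ → ∈units (-‿nonzero (units-nonzero x∈)) , neg-square x , -x≢x (units-nonzero x∈))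
      (λ _ _ → squares-equal)
      where
      root : ∀ {y} → y ∈ˡ units × IsSquare y → ∃ λ x → x ∈ˡ units × x * x ≡ y
      root (y∈ , x , refl) = x , ∈units (nonzeroˡ (units-nonzero y∈)) , refl

    length-nonsquares : length nonsquares ≡ length squares
    length-nonsquares = ℕ.+-cancelˡ-≡ (length squares) _ _ (begin
      length squares ℕ.+ length nonsquares  ≡⟨ length-filter-¬ isSquare? units ⟩
      length units                          ≡⟨ length-units-squares ⟩
      length squares ℕ.* 2                  ≡⟨ ℕ.*-comm (length squares) 2 ⟩
      length squares ℕ.+ (length squares ℕ.+ 0) ≡⟨ cong (length squares ℕ.+_) (ℕ.+-identityʳ _) ⟩
      length squares ℕ.+ length squares     ∎)

    -- There are as many nonsquares as nonzero squares, and 1 is a square.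
    ∃-nonsquare : ∃ λ n → ¬ n ≡ 0# × ¬ IsSquare n
    ∃-nonsquare = first nonsquares (λ z∈ → z∈) nonempty
      where
      nonempty : 1 ℕ.≤ length nonsquares
      nonempty = subst (1 ℕ.≤_) (sym length-nonsquares)
        (length-∈ (∈-filter⁺ isSquare? (∈units 1≢0) (1# , *-identityˡ 1#)))
        where
        length-∈ : ∀ {x} {xs : List (Fin q)} → x ∈ˡ xs → 1 ℕ.≤ length xs
        length-∈ (here _)  = ℕ.s≤s ℕ.z≤n
        length-∈ (there _) = ℕ.s≤s ℕ.z≤n
      first : ∀ xs → (∀ {z} → z ∈ˡ xs → z ∈ˡ nonsquares) → 1 ℕ.≤ length xs → ∃ λ n → ¬ n ≡ 0# × ¬ IsSquare n
      first (n ∷ _) sub _ with n∈ , ¬sq ← ∈-filter⁻ (¬? ∘ isSquare?) {xs = units} (sub (here refl)) =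
        n , units-nonzero n∈ , ¬sq

    -- n times the squares exhausts the nonsquares, by cardinality.
    nonsquare-product : ∀ {n u} → ¬ n ≡ 0# → ¬ u ≡ 0# → ¬ IsSquare n → ¬ IsSquare u → IsSquare (n * u)
    nonsquare-product {n} {u} n≢0 u≢0 ¬n ¬u with ∈-map⁻ (n *_) u∈
      where
      sub : ∀ {z} → z ∈ˡ List.map (n *_) squares → z ∈ˡ nonsquares
      sub z∈ with s , s∈ , refl ← ∈-map⁻ (n *_) z∈
        with s∈u , sq ← ∈-filter⁻ isSquare? {xs = units} s∈ =
        ∈-filter⁺ (¬? ∘ isSquare?) (∈units (*-nonzero n≢0 (units-nonzero s∈u)))
          (λ sq′ → ¬n (square-quotient (units-nonzero s∈u) sq (subst IsSquare (*-comm n s) sq′)))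
      u∈ : u ∈ˡ List.map (n *_) squares
      u∈ = unique-⊆-reverse Fin._≟_
        (Unique.map⁺ (*-cancelˡ n≢0) (Unique.filter⁺ isSquare? unique-units))
        (Unique.filter⁺ (¬? ∘ isSquare?) unique-units) sub
        (ℕ.≤-reflexive (trans length-nonsquares (sym (List.length-map (n *_) squares))))
        (∈-filter⁺ (¬? ∘ isSquare?) (∈units u≢0) ¬u)
    ... | s , s∈ , refl = subst IsSquare (*-assoc n n s)
      (square-product (n , refl) (proj₂ (∈-filter⁻ isSquare? {xs = units} s∈)))

    -- If a nonsquare u had u^m = 1, then every unit x would satisfy x^m = 1: squares by Fermat,
    -- nonsquares because ux is a square. That makes 2m roots of x^m - 1.
    euler : ∀ m {u} → length units ≡ m ℕ.+ m → u ^ m ≡ 1# → ¬ u ≡ 0# → IsSquare u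
    euler m {u} len u^m u≢0 with isSquare? u
    ... | yes sq = sq
    ... | no ¬sq = contradiction too-many (ℕ.<⇒≱ (ℕ.m<m+n m m>0))
      where
      half : ∀ {x} → ¬ x ≡ 0# → IsSquare x → x ^ m ≡ 1#
      half x≢0 (s , refl) = trans (square^ s m)
        (trans (cong (s ^_) (sym len)) (fermat (nonzeroˡ x≢0)))
      all-roots : ∀ {x} → x ∈ˡ units → x ^ m ≡ 1#
      all-roots {x} x∈ with isSquare? x
      ... | yes sq = half (units-nonzero x∈) sq
      ... | no ¬x = begin
        x ^ m             ≡⟨ *-identityˡ _ ⟨
        1# * x ^ m        ≡⟨ cong (_* x ^ m) u^m ⟨
        u ^ m * x ^ m     ≡⟨ ^-distrib-* u x m ⟨
        (u * x) ^ m       ≡⟨ half (*-nonzero u≢0 (units-nonzero x∈))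
                               (nonsquare-product u≢0 (units-nonzero x∈) ¬sq ¬x) ⟩
        1#                ∎
      positive : ∀ m → length units ≡ m ℕ.+ m → 0 ℕ.< m
      positive (suc m) _ = ℕ.s≤s ℕ.z≤n
      positive zero e with units | ∈units 1≢0
      positive zero () | _ ∷ _ | _
      m>0 = positive m len
      instance _ = ℕ.>-nonZero m>0
      too-many : m ℕ.+ m ℕ.≤ m
      too-many = subst (ℕ._≤ m) len (roots-of-unity-≤ m units unique-units all-roots)

    -1-square : q % 4 ≡ 1 → IsSquare (- 1#)
    -- With q - 1 = 4r, half of the group order is 2r, and (-1)^(2r) = ((-1)²)^r = 1.
    -1-square q%4 = euler (r ℕ.+ r) len (trans (sym (square^ (- 1#) r)) (trans (cong (_^ r) 1²) (1^ r))) (-‿nonzero 1≢0)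
      where
      r = q / 4
      1² : - 1# * - 1# ≡ 1#
      1² = trans (neg-square 1#) (*-identityˡ 1#)
      len : length units ≡ (r ℕ.+ r) ℕ.+ (r ℕ.+ r)
      len = ℕ.suc-injective (begin
        suc (length units)                       ≡⟨ length-units ⟩
        q                                        ≡⟨ m≡m%n+[m/n]*n q 4 ⟩
        q % 4 ℕ.+ r ℕ.* 4                        ≡⟨ cong₂ ℕ._+_ q%4 (ℕ.*-comm r 4) ⟩
        suc (r ℕ.+ (r ℕ.+ (r ℕ.+ (r ℕ.+ 0))))    ≡⟨ cong (λ z → suc (r ℕ.+ (r ℕ.+ (r ℕ.+ z)))) (ℕ.+-identityʳ r) ⟩
        suc (r ℕ.+ (r ℕ.+ (r ℕ.+ r)))            ≡⟨ cong suc (ℕ.+-assoc r r (r ℕ.+ r)) ⟨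
        suc ((r ℕ.+ r) ℕ.+ (r ℕ.+ r))            ∎)

  -- The subgroup B as the group of k-th roots of unity, and its square classes.

  module Subgroup (k : ℕ) (B : Subset q) (B-subgroup : IsMulSubgroupOfOrder F k B) .{{k≢0 : ℕ.NonZero k}} where
    B-elements : List (Fin q)
    B-elements = elements B

    0∉B : ¬ 0# ∈ B
    0∉B = proj₁ B-subgroup
    1∈B : 1# ∈ B
    1∈B = proj₁ (proj₂ B-subgroup)
    *∈B : ∀ {x y} → x ∈ B → y ∈ B → x * y ∈ B
    *∈B = proj₁ (proj₂ (proj₂ B-subgroup)) _ _
    inv∈B : ∀ {x} → x ∈ B → inv x ∈ B
    inv∈B = proj₁ (proj₂ (proj₂ (proj₂ B-subgroup))) _

    length-B : length B-elements ≡ k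
    length-B = trans (length-elements B) (proj₂ (proj₂ (proj₂ (proj₂ B-subgroup))))

    B-nonzero : ∀ {x} → x ∈ B → ¬ x ≡ 0#
    B-nonzero x∈ refl = 0∉B x∈

    B⇒^k≡1 : ∀ {x} → x ∈ B → x ^ k ≡ 1#
    B⇒^k≡1 {x} x∈ = subst (λ z → x ^ z ≡ 1#) length-B
      (translation-invariant⇒^≡1 B-elements x (unique-elements B) (0∉B ∘ ∈elements⇒∈) (B-nonzero x∈)
        (λ y∈ → ∈⇒∈elements (*∈B x∈ (∈elements⇒∈ y∈)))
        (λ y∈ → ∈⇒∈elements (*∈B (inv∈B x∈) (∈elements⇒∈ y∈))))

    -- B already supplies k roots of x^k - 1, so a root outside B would be one too many.
    ^k≡1⇒B : ∀ {x} → x ^ k ≡ 1# → x ∈ B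
    ^k≡1⇒B {x} x^k with x ∈? B
    ... | yes x∈ = x∈
    ... | no x∉ = contradiction
      (roots-of-unity-≤ k (x ∷ B-elements) (∉⇒unique-∷ (x∉ ∘ ∈elements⇒∈) (unique-elements B))
        (λ { (here refl) → x^k ; (there y∈) → B⇒^k≡1 (∈elements⇒∈ y∈) }))
      (ℕ.<⇒≱ (ℕ.≤-reflexive (cong suc (sym length-B))))

    module _ (2≢0 : ¬ 2 ·1 ≡ 0#) (e : ℕ) (ke≡q-1 : k ℕ.* e ≡ length units) where
      open OddCharacteristic 2≢0

      even-index⇒squares : e % 2 ≡ 0 → ∀ {x} → x ∈ B → IsSquare x
      -- For e = 2f the exponent (q - 1)/2 in Euler's criterion is kf, a multiple of k, and k-th
      -- powers of elements of B are 1.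
      even-index⇒squares e%2 {x} x∈ = euler (k ℕ.* f)
        (trans (sym ke≡q-1) (trans (cong (k ℕ.*_) e≡f+f) (ℕ.*-distribˡ-+ k f f)))
        (trans (sym (^-assocʳ x k f)) (trans (cong (_^ f) (B⇒^k≡1 x∈)) (1^ f)))
        (B-nonzero x∈)
        where
        f = e / 2
        e≡f+f : e ≡ f ℕ.+ f
        e≡f+f = begin
          e                    ≡⟨ m≡m%n+[m/n]*n e 2 ⟩
          e % 2 ℕ.+ f ℕ.* 2    ≡⟨ cong₂ ℕ._+_ e%2 (ℕ.*-comm f 2) ⟩
          f ℕ.+ (f ℕ.+ 0)      ≡⟨ cong (f ℕ.+_) (ℕ.+-identityʳ f) ⟩
          f ℕ.+ f              ∎

      -- If B consisted of squares, its square roots would lie in B again and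
      -- squaring would be a two-to-one map of B onto itself.
      odd-index⇒∃-nonsquare : e % 2 ≡ 1 → ∃ λ x → x ∈ B × ¬ IsSquare x
      odd-index⇒∃-nonsquare e%2 with Fin.any? (λ x → (x ∈? B) ×-dec ¬? (isSquare? x))
      ... | yes found = found
      ... | no none = contradiction
        (trans (sym length-B) (trans
          (length-two-to-one Fin._≟_ (λ x → x * x) (λ x → - x) B-elements B-elements
            (unique-elements B) (unique-elements B)
            (λ x∈ → ∈⇒∈elements (*∈B (∈elements⇒∈ x∈) (∈elements⇒∈ x∈)))
            (λ y∈ → root (∈elements⇒∈ y∈))
            (λ {x} x∈ → ∈⇒∈elements (root∈B { - x}
                (subst (_∈ B) (sym (neg-square x)) (*∈B (∈elements⇒∈ x∈) (∈elements⇒∈ x∈)))) ,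
              neg-square x , -x≢x (B-nonzero (∈elements⇒∈ x∈)))
            (λ _ _ → squares-equal))
          (cong (ℕ._* 2) length-B)))
        (ℕ.<⇒≢ (ℕ.m<m*n k 2 (ℕ.s≤s (ℕ.s≤s ℕ.z≤n))))
        where
        f = e / 2
        all-squares : ∀ {x} → x ∈ B → IsSquare x
        all-squares {x} x∈ = decidable-stable (isSquare? x) (λ ¬sq → none (x , x∈ , ¬sq))
        ke≡ : k ℕ.* e ≡ k ℕ.+ (k ℕ.+ k) ℕ.* f
        ke≡ = begin
          k ℕ.* e                          ≡⟨ cong (k ℕ.*_) (m≡m%n+[m/n]*n e 2) ⟩
          k ℕ.* (e % 2 ℕ.+ f ℕ.* 2)        ≡⟨ cong (λ z → k ℕ.* (z ℕ.+ f ℕ.* 2)) e%2 ⟩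
          k ℕ.* (1 ℕ.+ f ℕ.* 2)            ≡⟨ N.solve 2 (λ k f → k N.:* (N.con 1 N.:+ f N.:* N.con 2)
                                                N.:= k N.:+ (k N.:+ k) N.:* f) refl k f ⟩
          k ℕ.+ (k ℕ.+ k) ℕ.* f            ∎
          where module N = +-*-Solver
        root∈B : ∀ {s} → s * s ∈ B → s ∈ B
        -- For e = 2f + 1 the exponent q - 1 is k + 2kf. As s² lies in B, s^(2k) = 1, so s^k =
        -- s^(q-1) = 1.
        root∈B {s} s²∈ = ^k≡1⇒B (begin
          s ^ k                                  ≡⟨ *-identityʳ _ ⟨
          s ^ k * 1#                             ≡⟨ cong (s ^ k *_) (1^ f) ⟨
          s ^ k * 1# ^ f                         ≡⟨ cong (λ z → s ^ k * z ^ f) (trans (sym (square^ s k)) (B⇒^k≡1 s²∈)) ⟨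
          s ^ k * (s ^ (k ℕ.+ k)) ^ f            ≡⟨ cong (s ^ k *_) (^-assocʳ s (k ℕ.+ k) f) ⟩
          s ^ k * s ^ ((k ℕ.+ k) ℕ.* f)          ≡⟨ ^-homo-* s k ((k ℕ.+ k) ℕ.* f) ⟨
          s ^ (k ℕ.+ (k ℕ.+ k) ℕ.* f)            ≡⟨ cong (s ^_) (trans (sym ke≡) ke≡q-1) ⟩
          s ^ length units                       ≡⟨ fermat (nonzeroˡ (B-nonzero s²∈)) ⟩
          1#                                     ∎)
        root : ∀ {y} → y ∈ B → ∃ λ x → x ∈ˡ B-elements × x * x ≡ y
        root y∈ with s , refl ← all-squares y∈ = s , ∈⇒∈elements (root∈B y∈) , refl

-- Matrices acting on the projective line through homogeneous coordinates.

module Projective {q : ℕ} (F : FiniteField q) where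
  open Field F
  open Squares F
  open ≡-Reasoning

  record Matrix : Set where
    constructor mat
    field a b c d : Fin q

  mat-cong : ∀ {a b c d a′ b′ c′ d′} → a ≡ a′ → b ≡ b′ → c ≡ c′ → d ≡ d′ → mat a b c d ≡ mat a′ b′ c′ d′
  mat-cong refl refl refl refl = refl

  det : Matrix → Fin q
  det (mat a b c d) = a * d - b * c

  infixr 7 _⊙_ _⊡_
  _⊙_ : Matrix → Matrix → Matrix
  mat a b c d ⊙ mat a′ b′ c′ d′ =
    mat (a * a′ + b * c′) (a * b′ + b * d′) (c * a′ + d * c′) (c * b′ + d * d′)

  _⊡_ : Fin q → Matrix → Matrix
  r ⊡ mat a b c d = mat (r * a) (r * b) (r * c) (r * d)

  -- The adjugate serves as the inverse: on points it inverts the action of an invertible matrix,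
  -- with no division in its entries.
  adj : Matrix → Matrix
  adj (mat a b c d) = mat d (- b) (- c) a

  det-⊙ : ∀ m n → det (m ⊙ n) ≡ det m * det n
  det-⊙ (mat a b c d) (mat e f g h) =
    solve 8 (λ a b c d e f g h → (a :* e :+ b :* g) :* (c :* f :+ d :* h) :- (a :* f :+ b :* h) :* (c :* e :+ d :* g)
              := (a :* d :- b :* c) :* (e :* h :- f :* g)) refl a b c d e f g h

  det-⊡ : ∀ r m → det (r ⊡ m) ≡ r * r * det m
  det-⊡ r (mat a b c d) =
    solve 5 (λ r a b c d → r :* a :* (r :* d) :- r :* b :* (r :* c) := r :* r :* (a :* d :- b :* c)) refl r a b c d

  det-adj : ∀ m → det (adj m) ≡ det m
  det-adj (mat a b c d) = solve 4 (λ a b c d → d :* a :- :- b :* :- c := a :* d :- b :* c) refl a b c d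

  ⊙-adj-⊙ : ∀ h m → h ⊙ (adj h ⊙ m) ≡ det h ⊡ m
  ⊙-adj-⊙ (mat a b c d) (mat e f g h) = mat-cong (top e g) (top f h) (bottom e g) (bottom f h)
    where
    top : ∀ e g → a * (d * e + - b * g) + b * (- c * e + a * g) ≡ (a * d - b * c) * e
    top = solve 6 (λ a b c d e g → a :* (d :* e :+ :- b :* g) :+ b :* (:- c :* e :+ a :* g)
                    := (a :* d :- b :* c) :* e) refl a b c d
    bottom : ∀ e g → c * (d * e + - b * g) + d * (- c * e + a * g) ≡ (a * d - b * c) * g
    bottom = solve 6 (λ a b c d e g → c :* (d :* e :+ :- b :* g) :+ d :* (:- c :* e :+ a :* g)
                    := (a :* d :- b :* c) :* g) refl a b c d

  ⊙-⊡ : ∀ r m n → m ⊙ (r ⊡ n) ≡ r ⊡ (m ⊙ n)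
  ⊙-⊡ r (mat a b c d) (mat e f g h) = mat-cong (s a b e g) (s a b f h) (s c d e g) (s c d f h)
    where
    s : ∀ x y u v → x * (r * u) + y * (r * v) ≡ r * (x * u + y * v)
    s = solve 5 (λ r x y u v → x :* (r :* u) :+ y :* (r :* v) := r :* (x :* u :+ y :* v)) refl r

  ⊙-assoc : ∀ l m n → (l ⊙ m) ⊙ n ≡ l ⊙ (m ⊙ n)
  ⊙-assoc (mat a b c d) (mat e f g h) (mat i j k l) = mat-cong (s a b i k) (s a b j l) (s c d i k) (s c d j l)
    where
    s : ∀ x y u v → (x * e + y * g) * u + (x * f + y * h) * v ≡ x * (e * u + f * v) + y * (g * u + h * v)
    s = solve 8 (λ e f g h x y u v → (x :* e :+ y :* g) :* u :+ (x :* f :+ y :* h) :* v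
                  := x :* (e :* u :+ f :* v) :+ y :* (g :* u :+ h :* v)) refl e f g h

  Pt : Set
  Pt = Point F

  pt : Fin q → Pt
  pt = Fin.suc

  num den : Pt → Fin q
  num Fin.zero    = 1#
  num (Fin.suc z) = z
  den Fin.zero    = 0#
  den (Fin.suc z) = 1#

  top bottom : Matrix → Pt → Fin q
  top    (mat a b c d) P = a * num P + b * den P
  bottom (mat a b c d) P = c * num P + d * den P

  -- The matrix sends P to Q: its value at the homogeneous coordinates of P is
  -- proportional to those of Q.
  record Maps (m : Matrix) (P Q : Pt) : Set where
    constructor mk
    field proportion : top m P * den Q ≡ num Q * bottom m P

  apply : Matrix → Pt → Pt
  apply (mat a b c d) = act F a b c d

  -- Ties `act` to the relation `Maps`; the case distinctions of `act` are opened here and nowhere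
  -- else.
  apply-proportion : ∀ m P → top m P * den (apply m P) ≡ num (apply m P) * bottom m P
  apply-proportion (mat a b c d) Fin.zero with c Fin.≟ 0#
  ... | yes refl = solve 3 (λ a b d → (a :* :1 :+ b :* :0) :* :0 := :1 :* (:0 :* :1 :+ d :* :0)) refl a b d
  ... | no c≢0 = begin
    (a * 1# + b * 0#) * 1#                   ≡⟨ solve 2 (λ a b → (a :* :1 :+ b :* :0) :* :1 := a :* :1) refl a b ⟩
    a * 1#                                   ≡⟨ cong (a *_) (inverseˡ c≢0) ⟨
    a * (inv c * c)                          ≡⟨ solve 4 (λ a i c d → a :* (i :* c) := a :* i :* (c :* :1 :+ d :* :0)) refl a (inv c) c d ⟩
    a * inv c * (c * 1# + d * 0#)            ∎
  apply-proportion (mat a b c d) (Fin.suc z) with (c * z + d) Fin.≟ 0#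
  ... | yes e = begin
    (a * z + b * 1#) * 0#                    ≡⟨ zeroʳ _ ⟩
    0#                                       ≡⟨ e ⟨
    c * z + d                                ≡⟨ solve 3 (λ c z d → c :* z :+ d := :1 :* (c :* z :+ d :* :1)) refl c z d ⟩
    1# * (c * z + d * 1#)                    ∎
  ... | no v≢0 = begin
    (a * z + b * 1#) * 1#                    ≡⟨ solve 3 (λ a z b → (a :* z :+ b :* :1) :* :1 := (a :* z :+ b) :* :1) refl a z b ⟩
    (a * z + b) * 1#                         ≡⟨ cong ((a * z + b) *_) (inverseˡ v≢0) ⟨
    (a * z + b) * (inv (c * z + d) * (c * z + d))
      ≡⟨ solve 5 (λ u i c z d → u :* (i :* (c :* z :+ d)) := u :* i :* (c :* z :+ d :* :1)) refl (a * z + b) (inv (c * z + d)) c z d ⟩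
    (a * z + b) * inv (c * z + d) * (c * z + d * 1#) ∎

  maps-apply : ∀ m P → Maps m P (apply m P)
  maps-apply m P = mk (apply-proportion m P)

  -- Cramer's rule: the determinant times either coordinate of `P` is a linear combination of
  -- `top m P` and `bottom m P`, and no point has both coordinates zero.
  value-nonzero : ∀ m P → ¬ det m ≡ 0# → top m P ≡ 0# → bottom m P ≡ 0# → ⊥
  value-nonzero (mat a b c d) P det≢0 u v = coordinates P (*-cancel-0ˡ det≢0 det*num) (*-cancel-0ˡ det≢0 det*den)
    where
    X = num P
    Y = den P
    coordinates : ∀ P → num P ≡ 0# → den P ≡ 0# → ⊥
    coordinates Fin.zero    e _ = 1≢0 e
    coordinates (Fin.suc _) _ e = 1≢0 e
    zeros : ∀ {s t} x y → s ≡ 0# → t ≡ 0# → x * s - y * t ≡ 0#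
    zeros x y refl refl = solve 2 (λ x y → x :* :0 :- y :* :0 := :0) refl x y
    det*num : (a * d - b * c) * X ≡ 0#
    det*num = trans
      (solve 6 (λ a b c d X Y → (a :* d :- b :* c) :* X := d :* (a :* X :+ b :* Y) :- b :* (c :* X :+ d :* Y)) refl a b c d X Y)
      (zeros d b u v)
    det*den : (a * d - b * c) * Y ≡ 0#
    det*den = trans
      (solve 6 (λ a b c d X Y → (a :* d :- b :* c) :* Y := a :* (c :* X :+ d :* Y) :- c :* (a :* X :+ b :* Y)) refl a b c d X Y)
      (zeros a c v u)

  -- The coordinates are normalised: for a nonzero vector (u, v), v = 0 forces the point ∞, and v ≠
  -- 0 forces the point u/v.
  proportional-unique : ∀ {u v} → (u ≡ 0# → v ≡ 0# → ⊥) → ∀ Q Q′ →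
    u * den Q ≡ num Q * v → u * den Q′ ≡ num Q′ * v → Q ≡ Q′
  proportional-unique nz Fin.zero    Fin.zero    _ _ = refl
  proportional-unique {u} {v} nz Fin.zero (Fin.suc z) e e′ = contradiction v≡0 (nz u≡0)
    where
    v≡0 : v ≡ 0#
    v≡0 = trans (sym (*-identityˡ v)) (trans (sym e) (zeroʳ u))
    u≡0 : u ≡ 0#
    u≡0 = trans (sym (*-identityʳ u)) (trans e′ (trans (cong (z *_) v≡0) (zeroʳ z)))
  proportional-unique nz (Fin.suc z) Fin.zero e e′ = sym (proportional-unique nz Fin.zero (Fin.suc z) e′ e)
  proportional-unique {u} {v} nz (Fin.suc z) (Fin.suc z′) e e′ = cong Fin.suc (*-cancelˡ v≢0 (begin
    v * z    ≡⟨ *-comm v z ⟩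
    z * v    ≡⟨ trans (sym e) e′ ⟩
    z′ * v   ≡⟨ *-comm z′ v ⟩
    v * z′   ∎))
    where
    v≢0 : ¬ v ≡ 0#
    v≢0 v≡0 = nz (trans (sym (*-identityʳ u)) (trans e (trans (cong (z *_) v≡0) (zeroʳ z)))) v≡0

  maps-unique : ∀ m {P Q Q′} → ¬ det m ≡ 0# → Maps m P Q → Maps m P Q′ → Q ≡ Q′
  maps-unique m {P} {Q} {Q′} det≢0 (mk e) (mk e′) = proportional-unique (value-nonzero m P det≢0) Q Q′ e e′

  maps-adj : ∀ m {P Q} → Maps m P Q → Maps (adj m) Q P
  maps-adj (mat a b c d) {P} {Q} (mk e) = mk (begin
    (d * U + - b * V) * Y
      ≡⟨ solve 7 (λ b c d X Y U V → (d :* U :+ :- b :* V) :* Y := U :* (c :* X :+ d :* Y) :- X :* (c :* U) :- b :* Y :* V) refl b c d X Y U V ⟩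
    U * (c * X + d * Y) - X * (c * U) - b * Y * V
      ≡⟨ cong (λ z → z - X * (c * U) - b * Y * V) e ⟨
    (a * X + b * Y) * V - X * (c * U) - b * Y * V
      ≡⟨ solve 7 (λ a b c X Y U V → (a :* X :+ b :* Y) :* V :- X :* (c :* U) :- b :* Y :* V := X :* (:- c :* U :+ a :* V)) refl a b c X Y U V ⟩
    X * (- c * U + a * V)   ∎)
    where
    X = num P
    Y = den P
    U = num Q
    V = den Q

  maps-injective : ∀ m {P P′ Q} → ¬ det m ≡ 0# → Maps m P Q → Maps m P′ Q → P ≡ P′
  maps-injective m det≢0 e e′ =
    maps-unique (adj m) (det≢0 ∘ trans (sym (det-adj m))) (maps-adj m e) (maps-adj m e′)

  maps-⊙ : ∀ n m {P Q R} → Maps m P Q → Maps n Q R → Maps (n ⊙ m) P R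
  maps-⊙ (mat a b c d) (mat a′ b′ c′ d′) {P} {Q} {R} (mk e) (mk e′) = mk (begin
    ((a * a′ + b * c′) * X + (a * b′ + b * d′) * Y) * V
      ≡⟨ cong (_* V) (regroup a b) ⟩
    (a * u + b * v) * V
      ≡⟨ combine Q e e′ ⟩
    U * (c * u + d * v)
      ≡⟨ cong (U *_) (regroup c d) ⟨
    U * ((c * a′ + d * c′) * X + (c * b′ + d * d′) * Y) ∎)
    where
    X = num P
    Y = den P
    U = num R
    V = den R
    u = a′ * X + b′ * Y
    v = c′ * X + d′ * Y
    regroup : ∀ x y → (x * a′ + y * c′) * X + (x * b′ + y * d′) * Y ≡ x * u + y * v
    regroup = solve 8 (λ a′ b′ c′ d′ X Y x y → (x :* a′ :+ y :* c′) :* X :+ (x :* b′ :+ y :* d′) :* Y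
                        := x :* (a′ :* X :+ b′ :* Y) :+ y :* (c′ :* X :+ d′ :* Y)) refl a′ b′ c′ d′ X Y
    -- Chaining the two proportions requires (u, v) as an explicit multiple of the coordinates of
    -- `Q`: it is u · (1, 0) when `Q` is ∞ and v · (z, 1) when `Q` is z.
    combine : ∀ Q → u * den Q ≡ num Q * v → (a * num Q + b * den Q) * V ≡ U * (c * num Q + d * den Q) →
      (a * u + b * v) * V ≡ U * (c * u + d * v)
    combine Fin.zero e e′ = begin
      (a * u + b * v) * V            ≡⟨ cong (λ z → (a * u + b * z) * V) v≡0 ⟩
      (a * u + b * 0#) * V           ≡⟨ solve 4 (λ a b u V → (a :* u :+ b :* :0) :* V := u :* ((a :* :1 :+ b :* :0) :* V)) refl a b u V ⟩
      u * ((a * 1# + b * 0#) * V)    ≡⟨ cong (u *_) e′ ⟩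
      u * (U * (c * 1# + d * 0#))    ≡⟨ solve 4 (λ c d u U → u :* (U :* (c :* :1 :+ d :* :0)) := U :* (c :* u :+ d :* :0)) refl c d u U ⟩
      U * (c * u + d * 0#)           ≡⟨ cong (λ z → U * (c * u + d * z)) v≡0 ⟨
      U * (c * u + d * v)            ∎
      where
      v≡0 : v ≡ 0#
      v≡0 = trans (sym (*-identityˡ v)) (trans (sym e) (zeroʳ u))
    combine (Fin.suc z) e e′ = begin
      (a * u + b * v) * V            ≡⟨ cong (λ w → (a * w + b * v) * V) u≡zv ⟩
      (a * (z * v) + b * v) * V      ≡⟨ solve 5 (λ a b z v V → (a :* (z :* v) :+ b :* v) :* V := v :* ((a :* z :+ b :* :1) :* V)) refl a b z v V ⟩
      v * ((a * z + b * 1#) * V)     ≡⟨ cong (v *_) e′ ⟩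
      v * (U * (c * z + d * 1#))     ≡⟨ solve 5 (λ c d z v U → v :* (U :* (c :* z :+ d :* :1)) := U :* (c :* (z :* v) :+ d :* v)) refl c d z v U ⟩
      U * (c * (z * v) + d * v)      ≡⟨ cong (λ w → U * (c * w + d * v)) u≡zv ⟨
      U * (c * u + d * v)            ∎
      where
      u≡zv : u ≡ z * v
      u≡zv = trans (sym (*-identityʳ u)) e

  private
    scaled-sum : ∀ r a b X Y Z → (r * a * X + r * b * Y) * Z ≡ r * ((a * X + b * Y) * Z)
    scaled-sum = solve 6 (λ r a b X Y Z → (r :* a :* X :+ r :* b :* Y) :* Z := r :* ((a :* X :+ b :* Y) :* Z)) refl

  maps-⊡⁺ : ∀ r m {P Q} → Maps m P Q → Maps (r ⊡ m) P Q
  maps-⊡⁺ r (mat a b c d) {P} {Q} (mk e) = mk (begin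
    top (r ⊡ mat a b c d) P * den Q       ≡⟨ scaled-sum r a b _ _ _ ⟩
    r * (top (mat a b c d) P * den Q)     ≡⟨ cong (r *_) (trans e (*-comm _ _)) ⟩
    r * (bottom (mat a b c d) P * num Q)  ≡⟨ scaled-sum r c d _ _ _ ⟨
    bottom (r ⊡ mat a b c d) P * num Q    ≡⟨ *-comm _ _ ⟩
    num Q * bottom (r ⊡ mat a b c d) P    ∎)

  maps-⊡⁻ : ∀ r m {P Q} → ¬ r ≡ 0# → Maps (r ⊡ m) P Q → Maps m P Q
  maps-⊡⁻ r (mat a b c d) {P} {Q} r≢0 (mk e) = mk (*-cancelˡ r≢0 (begin
    r * (top (mat a b c d) P * den Q)     ≡⟨ scaled-sum r a b _ _ _ ⟨
    top (r ⊡ mat a b c d) P * den Q       ≡⟨ trans e (*-comm _ _) ⟩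
    bottom (r ⊡ mat a b c d) P * num Q    ≡⟨ scaled-sum r c d _ _ _ ⟩
    r * (bottom (mat a b c d) P * num Q)  ≡⟨ cong (r *_) (*-comm _ _) ⟩
    r * (num Q * bottom (mat a b c d) P)  ∎))

  -- Matrices with prescribed behaviour at three points.

  bracket : Pt → Pt → Fin q
  bracket P Q = num P * den Q - num Q * den P

  -- The bracket is the determinant of the two coordinate vectors, so its vanishing makes the
  -- coordinates of `P` proportional to those of `Q`.
  bracket-0 : ∀ P Q → bracket P Q ≡ 0# → P ≡ Q
  bracket-0 P Q e = proportional-unique {num P} {den P} (nz P) P Q refl (x-y≡0⇒x≡y e)
    where
    nz : ∀ P → num P ≡ 0# → den P ≡ 0# → ⊥
    nz Fin.zero    e _ = 1≢0 e
    nz (Fin.suc _) _ e = 1≢0 e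

  -- The Plücker relation [R,Q] P + [P,R] Q = [P,Q] R makes the sum of the columns
  -- a multiple of R.
  frame : Pt → Pt → Pt → Matrix
  frame P Q R = mat (bracket R Q * num P) (bracket P R * num Q) (bracket R Q * den P) (bracket P R * den Q)

  det-frame : ∀ P Q R → det (frame P Q R) ≡ bracket R Q * bracket P R * bracket P Q
  det-frame P Q R = solve 6 (λ l m x y u v → l :* x :* (m :* v) :- m :* u :* (l :* y) := l :* m :* (x :* v :- u :* y))
    refl (bracket R Q) (bracket P R) (num P) (den P) (num Q) (den Q)

  det-frame-nonzero : ∀ {P Q R} → ¬ P ≡ Q → ¬ P ≡ R → ¬ Q ≡ R → ¬ det (frame P Q R) ≡ 0#
  det-frame-nonzero {P} {Q} {R} P≢Q P≢R Q≢R e =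
    *-nonzero (*-nonzero (Q≢R ∘ sym ∘ bracket-0 R Q) (P≢R ∘ bracket-0 P R)) (P≢Q ∘ bracket-0 P Q)
      (trans (sym (det-frame P Q R)) e)

  frame-∞ : ∀ P Q R → Maps (frame P Q R) (∞ F) P
  frame-∞ P Q R = mk (solve 6 (λ l m x y u v → (l :* x :* :1 :+ m :* u :* :0) :* y := x :* (l :* y :* :1 :+ m :* v :* :0))
    refl (bracket R Q) (bracket P R) (num P) (den P) (num Q) (den Q))

  frame-0 : ∀ P Q R → Maps (frame P Q R) (pt 0#) Q
  frame-0 P Q R = mk (solve 6 (λ l m x y u v → (l :* x :* :0 :+ m :* u :* :1) :* v := u :* (l :* y :* :0 :+ m :* v :* :1))
    refl (bracket R Q) (bracket P R) (num P) (den P) (num Q) (den Q))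

  frame-1 : ∀ P Q R → Maps (frame P Q R) (pt 1#) R
  frame-1 P Q R = mk (solve 6 (λ x y u v s t →
      ((s :* v :- u :* t) :* x :* :1 :+ (x :* t :- s :* y) :* u :* :1) :* t
      := s :* ((s :* v :- u :* t) :* y :* :1 :+ (x :* t :- s :* y) :* v :* :1))
    refl (num P) (den P) (num Q) (den Q) (num R) (den R))

  -- The matrix sending 1, u, v to ∞, 0, 1.
  normal : Fin q → Fin q → Matrix
  normal u v = mat (v - 1#) (- ((v - 1#) * u)) (v - u) (- (v - u))

  det-normal : ∀ u v → det (normal u v) ≡ (v - 1#) * (v - u) * (u - 1#)
  det-normal = solve 2 (λ u v → (v :- :1) :* :- (v :- u) :- :- ((v :- :1) :* u) :* (v :- u)
    := (v :- :1) :* (v :- u) :* (u :- :1)) refl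

  det-normal-nonzero : ∀ {u v} → ¬ u ≡ 1# → ¬ v ≡ 1# → ¬ u ≡ v → ¬ det (normal u v) ≡ 0#
  det-normal-nonzero {u} {v} u≢1 v≢1 u≢v e =
    *-nonzero (*-nonzero (v≢1 ∘ x-y≡0⇒x≡y) (u≢v ∘ sym ∘ x-y≡0⇒x≡y)) (u≢1 ∘ x-y≡0⇒x≡y) (trans (sym (det-normal u v)) e)

  normal-1 : ∀ u v → Maps (normal u v) (pt 1#) (∞ F)
  normal-1 u v = mk (solve 2 (λ u v → ((v :- :1) :* :1 :+ :- ((v :- :1) :* u) :* :1) :* :0
    := :1 :* ((v :- u) :* :1 :+ :- (v :- u) :* :1)) refl u v)

  normal-u : ∀ u v → Maps (normal u v) (pt u) (pt 0#)
  normal-u u v = mk (solve 2 (λ u v → ((v :- :1) :* u :+ :- ((v :- :1) :* u) :* :1) :* :1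
    := :0 :* ((v :- u) :* u :+ :- (v :- u) :* :1)) refl u v)

  normal-v : ∀ u v → Maps (normal u v) (pt v) (pt 1#)
  normal-v u v = mk (solve 2 (λ u v → ((v :- :1) :* v :+ :- ((v :- :1) :* u) :* :1) :* :1
    := :1 :* ((v :- u) :* v :+ :- (v :- u) :* :1)) refl u v)

  -- The first condition gives d = -c and the second b = -au. The third then determines c from a, so
  -- a is the only free entry, and comparing it with the entry v - 1 of `normal u v` gives r = a /
  -- (v - 1).
  normal-unique : ∀ m {u v} → ¬ v ≡ 1# →
    Maps m (pt 1#) (∞ F) → Maps m (pt u) (pt 0#) → Maps m (pt v) (pt 1#) →
    ∃ λ r → m ≡ r ⊡ normal u v
  normal-unique (mat a b c d) {u} {v} v≢1 (mk e₁) (mk e₂) (mk e₃) = r , mat-cong a≡ b≡ c≡ d≡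
    where
    w = v - 1#
    w≢0 : ¬ w ≡ 0#
    w≢0 = v≢1 ∘ x-y≡0⇒x≡y
    r = a * inv w
    d≡-c : d ≡ - c
    d≡-c = begin
      d                                ≡⟨ solve 2 (λ c d → d := :1 :* (c :* :1 :+ d :* :1) :- c) refl c d ⟩
      1# * (c * 1# + d * 1#) - c       ≡⟨ cong (_- c) e₁ ⟨
      (a * 1# + b * 1#) * 0# - c       ≡⟨ solve 3 (λ a b c → (a :* :1 :+ b :* :1) :* :0 :- c := :- c) refl a b c ⟩
      - c                              ∎
    b≡-au : b ≡ - (a * u)
    b≡-au = begin
      b                                ≡⟨ solve 3 (λ a b u → b := (a :* u :+ b :* :1) :* :1 :- a :* u) refl a b u ⟩
      (a * u + b * 1#) * 1# - a * u    ≡⟨ cong (_- a * u) e₂ ⟩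
      0# * (c * u + d * 1#) - a * u    ≡⟨ solve 4 (λ a c d u → :0 :* (c :* u :+ d :* :1) :- a :* u := :- (a :* u)) refl a c d u ⟩
      - (a * u)                        ∎
    a≡ : a ≡ r * w
    a≡ = begin
      a                 ≡⟨ *-identityʳ a ⟨
      a * 1#            ≡⟨ cong (a *_) (inverseˡ w≢0) ⟨
      a * (inv w * w)   ≡⟨ *-assoc _ _ _ ⟨
      r * w             ∎
    b≡ : b ≡ r * - (w * u)
    b≡ = begin
      b                 ≡⟨ b≡-au ⟩
      - (a * u)         ≡⟨ cong (λ z → - (z * u)) a≡ ⟩
      - (r * w * u)     ≡⟨ solve 3 (λ r w u → :- (r :* w :* u) := r :* :- (w :* u)) refl r w u ⟩
      r * - (w * u)     ∎
    c≡ : c ≡ r * (v - u)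
    c≡ = *-cancelˡ w≢0 (begin
      (v - 1#) * c                     ≡⟨ solve 2 (λ v c → (v :- :1) :* c := :1 :* (c :* v :+ :- c :* :1)) refl v c ⟩
      1# * (c * v + - c * 1#)          ≡⟨ cong (λ z → 1# * (c * v + z * 1#)) d≡-c ⟨
      1# * (c * v + d * 1#)            ≡⟨ e₃ ⟨
      (a * v + b * 1#) * 1#            ≡⟨ cong (λ z → (a * v + z * 1#) * 1#) b≡-au ⟩
      (a * v + - (a * u) * 1#) * 1#    ≡⟨ solve 3 (λ a u v → (a :* v :+ :- (a :* u) :* :1) :* :1 := a :* (v :- u)) refl a u v ⟩
      a * (v - u)                      ≡⟨ cong (_* (v - u)) a≡ ⟩
      r * w * (v - u)                  ≡⟨ solve 3 (λ r w x → r :* w :* x := w :* (r :* x)) refl r w (v - u) ⟩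
      w * (r * (v - u))                ∎)
    d≡ : d ≡ r * - (v - u)
    d≡ = begin
      d                 ≡⟨ d≡-c ⟩
      - c               ≡⟨ cong -_ c≡ ⟩
      - (r * (v - u))   ≡⟨ solve 2 (λ r x → :- (r :* x) := r :* :- x) refl r (v - u) ⟩
      r * - (v - u)     ∎

  -- Images of B and their behaviour under matrix products and scalars.

  module Images (B : Subset q) where

    img : Matrix → Subset (suc q)
    img (mat a b c d) = image F a b c d B

    private
      -- The decision that `image` tabulates, named so that table entries can be converted to
      -- witnesses and back.
      preimage? : ∀ m y → Dec (∃ λ x → x ∈ B × apply m (pt x) ≡ y)
      preimage? m y = Fin.any? (λ x → (x ∈? B) ×-dec (apply m (pt x) Fin.≟ y))

    ∈img⁻ : ∀ m {y} → y ∈ img m → ∃ λ x → x ∈ B × Maps m (pt x) y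
    ∈img⁻ m@(mat _ _ _ _) {y} y∈
      with x , x∈ , eq ← toWitness {a? = preimage? m y}
             (subst Bool.T (trans (sym (Vec.[]=⇒lookup y∈)) (Vec.lookup∘tabulate (λ y → isYes (preimage? m y)) y)) _) =
      x , x∈ , subst (Maps m (pt x)) eq (maps-apply m (pt x))

    ∈img⁺ : ∀ m {x y} → ¬ det m ≡ 0# → x ∈ B → Maps m (pt x) y → y ∈ img m
    ∈img⁺ m@(mat _ _ _ _) {x} {y} det≢0 x∈ e = Vec.lookup⇒[]= y (img m) (trans (Vec.lookup∘tabulate (λ y → isYes (preimage? m y)) y)
      (T⇒≡true (fromWitness {a? = preimage? m y} (x , x∈ , maps-unique m det≢0 (maps-apply m (pt x)) e))))
      where
      T⇒≡true : ∀ {b} → Bool.T b → b ≡ true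
      T⇒≡true {true} _ = refl

    -- `D` maps B onto B, so applying it first only re-indexes the image under `m`.
    img-⊙ : ∀ m D → ¬ det m ≡ 0# → ¬ det D ≡ 0# →
      (∀ {x} → x ∈ B → ∃ λ x′ → x′ ∈ B × Maps D (pt x) (pt x′)) →
      (∀ {x′} → x′ ∈ B → ∃ λ x → x ∈ B × Maps D (pt x) (pt x′)) →
      img (m ⊙ D) ≡ img m
    img-⊙ m D m≢0 D≢0 fwd bwd = ⊆-antisym sub sup
      where
      mD≢0 : ¬ det (m ⊙ D) ≡ 0#
      mD≢0 = *-nonzero m≢0 D≢0 ∘ trans (sym (det-⊙ m D))
      sub : img (m ⊙ D) ⊆ img m
      sub y∈ with x , x∈ , e ← ∈img⁻ (m ⊙ D) y∈ with x′ , x′∈ , e′ ← fwd x∈ =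
        ∈img⁺ m m≢0 x′∈ (subst (Maps m (pt x′))
          (maps-unique (m ⊙ D) mD≢0 (maps-⊙ m D e′ (maps-apply m (pt x′))) e) (maps-apply m (pt x′)))
      sup : img m ⊆ img (m ⊙ D)
      sup y∈ with x′ , x′∈ , e ← ∈img⁻ m y∈ with x , x∈ , e′ ← bwd x′∈ =
        ∈img⁺ (m ⊙ D) mD≢0 x∈ (maps-⊙ m D e′ e)

    img-⊡ : ∀ r m → ¬ r ≡ 0# → ¬ det m ≡ 0# → img (r ⊡ m) ≡ img m
    img-⊡ r m r≢0 m≢0 = ⊆-antisym sub sup
      where
      sub : img (r ⊡ m) ⊆ img m
      sub y∈ with x , x∈ , e ← ∈img⁻ (r ⊡ m) y∈ = ∈img⁺ m m≢0 x∈ (maps-⊡⁻ r m r≢0 e)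
      sup : img m ⊆ img (r ⊡ m)
      sup y∈ with x , x∈ , e ← ∈img⁻ m y∈ =
        ∈img⁺ (r ⊡ m) (*-nonzero (*-nonzero r≢0 r≢0) m≢0 ∘ trans (sym (det-⊡ r m))) x∈ (maps-⊡⁺ r m e)

    ∣img∣ : ∀ m → ¬ det m ≡ 0# → ∣ img m ∣ ≡ ∣ B ∣
    ∣img∣ m m≢0 = begin
      ∣ img m ∣                            ≡⟨ length-elements (img m) ⟨
      length (elements (img m))            ≡⟨ unique-length (unique-elements (img m)) (Unique.map⁺ inj (unique-elements B)) fwd bwd ⟩
      length (List.map f (elements B))     ≡⟨ List.length-map f (elements B) ⟩
      length (elements B)                  ≡⟨ length-elements B ⟩
      ∣ B ∣                                ∎
      where
      f : Fin q → Pt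
      f x = apply m (pt x)
      inj : ∀ {x y} → f x ≡ f y → x ≡ y
      inj {x} {y} e = Fin.suc-injective (maps-injective m m≢0
        (subst (Maps m (pt x)) e (maps-apply m (pt x))) (maps-apply m (pt y)))
      fwd : ∀ {z} → z ∈ˡ elements (img m) → z ∈ˡ List.map f (elements B)
      fwd z∈ with x , x∈ , e ← ∈img⁻ m (∈elements⇒∈ z∈) =
        subst (_∈ˡ _) (maps-unique m m≢0 (maps-apply m (pt x)) e) (∈-map⁺ f (∈⇒∈elements x∈))
      bwd : ∀ {z} → z ∈ˡ List.map f (elements B) → z ∈ˡ elements (img m)
      bwd z∈ with x , x∈ , refl ← ∈-map⁻ f z∈ = ∈⇒∈elements (∈img⁺ m m≢0 (∈elements⇒∈ x∈) (maps-apply m (pt x)))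

    -- The stabiliser of B and the square class of the determinant.

    module Stabiliser (n : ℕ) (B-subgroup : IsMulSubgroupOfOrder F (3 ℕ.+ n) B)
      (k≢0 : ¬ (3 ℕ.+ n) ·1 ≡ 0#) (k-1≢0 : ¬ (2 ℕ.+ n) ·1 ≡ 0#) where
      open Subgroup (3 ℕ.+ n) B B-subgroup

      scaling : Fin q → Matrix
      scaling b = mat b 0# 0# 1#

      inversion : Matrix
      inversion = mat 0# 1# 1# 0#

      det-scaling : ∀ b → det (scaling b) ≡ b
      det-scaling = solve 1 (λ b → b :* :1 :- :0 :* :0 := b) refl

      det-inversion : det inversion ≡ - 1#
      det-inversion = solve 0 (:0 :* :0 :- :1 :* :1 := :- :1) refl

      det-inversion≢0 : ¬ det inversion ≡ 0#
      det-inversion≢0 = -‿nonzero 1≢0 ∘ trans (sym det-inversion)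

      maps-scaling : ∀ b x → Maps (scaling b) (pt x) (pt (b * x))
      maps-scaling b x = mk (solve 2 (λ b x → (b :* x :+ :0 :* :1) :* :1 := b :* x :* (:0 :* x :+ :1 :* :1)) refl b x)

      maps-inversion : ∀ {x y} → x * y ≡ 1# → Maps inversion (pt x) (pt y)
      maps-inversion {x} {y} e = mk (begin
        (0# * x + 1# * 1#) * 1#   ≡⟨ solve 1 (λ x → (:0 :* x :+ :1 :* :1) :* :1 := :1) refl x ⟩
        1#                        ≡⟨ e ⟨
        x * y                     ≡⟨ solve 2 (λ x y → x :* y := y :* (:1 :* x :+ :0 :* :1)) refl x y ⟩
        y * (1# * x + 0# * 1#)    ∎)

      img-scaling : ∀ m {b} → ¬ det m ≡ 0# → b ∈ B → img (m ⊙ scaling b) ≡ img m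
      img-scaling m {b} m≢0 b∈ = img-⊙ m (scaling b) m≢0 (B-nonzero b∈ ∘ trans (sym (det-scaling b)))
        (λ {x} x∈ → b * x , *∈B b∈ x∈ , maps-scaling b x)
        (λ {x} x∈ → inv b * x , *∈B (inv∈B b∈) x∈ ,
          subst (λ z → Maps (scaling b) (pt (inv b * x)) (pt z)) (*inv-cancel x (B-nonzero b∈)) (maps-scaling b (inv b * x)))

      img-inversion : ∀ m → ¬ det m ≡ 0# → img (m ⊙ inversion) ≡ img m
      img-inversion m m≢0 = img-⊙ m inversion m≢0 det-inversion≢0
        (λ {x} x∈ → inv x , inv∈B x∈ , maps-inversion (inverse x (B-nonzero x∈)))
        (λ {x} x∈ → inv x , inv∈B x∈ , maps-inversion (inverseˡ (B-nonzero x∈)))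

      IsDiagonalOrAnti : Matrix → Set
      IsDiagonalOrAnti (mat a b c d) = (b ≡ 0# × c ≡ 0#) ⊎ (a ≡ 0# × d ≡ 0#)

      -- If g sends r in B to w in B, then ar + b = w (cr + d) with w^k = 1. The k-th powers of the
      -- two linear forms thus agree at all k elements of B.
      stabiliser : ∀ g → ¬ det g ≡ 0# → (∀ {x} → x ∈ B → ∃ λ w → w ∈ B × Maps g (pt x) (pt w)) → IsDiagonalOrAnti g
      stabiliser (mat a b c d) det≢0 into = uncurry (diagonal-or-antidiagonal n a b c d det≢0)
        (agreeing-powers n (elements B) a b c d (unique-elements B) (ℕ.≤-reflexive (sym length-B))
               (B⇒^k≡1 ∘ ∈elements⇒∈) (agree ∘ ∈elements⇒∈) k≢0 k-1≢0)
        where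
        agree : ∀ {r} → r ∈ B → (a * r + b) ^ (3 ℕ.+ n) ≡ (c * r + d) ^ (3 ℕ.+ n)
        agree {r} r∈ with w , w∈ , mk e ← into r∈ = begin
          (a * r + b) ^ (3 ℕ.+ n)
            ≡⟨ cong (_^ (3 ℕ.+ n)) (solve 3 (λ a r b → a :* r :+ b := (a :* r :+ b :* :1) :* :1) refl a r b) ⟩
          ((a * r + b * 1#) * 1#) ^ (3 ℕ.+ n)
            ≡⟨ cong (_^ (3 ℕ.+ n)) e ⟩
          (w * (c * r + d * 1#)) ^ (3 ℕ.+ n)
            ≡⟨ ^-distrib-* w _ (3 ℕ.+ n) ⟩
          w ^ (3 ℕ.+ n) * (c * r + d * 1#) ^ (3 ℕ.+ n)
            ≡⟨ cong₂ (λ s t → s * t ^ (3 ℕ.+ n)) (B⇒^k≡1 w∈) (cong (c * r +_) (*-identityʳ d)) ⟩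
          1# * (c * r + d) ^ (3 ℕ.+ n)
            ≡⟨ *-identityˡ _ ⟩
          (c * r + d) ^ (3 ℕ.+ n) ∎

      -- Up to a scalar, `adj m′ ⊙ m` is the quotient of the two matrices, and it maps B into
      -- itself.
      equal-images⇒monomial : ∀ m m′ → ¬ det m ≡ 0# → ¬ det m′ ≡ 0# → img m ≡ img m′ →
        IsDiagonalOrAnti (adj m′ ⊙ m)
      equal-images⇒monomial m m′ m≢0 m′≢0 eq = stabiliser (adj m′ ⊙ m)
        (*-nonzero m′≢0 m≢0 ∘ trans (sym (trans (det-⊙ (adj m′) m) (cong (_* det m) (det-adj m′)))))
        λ {x} x∈ → let
          y = apply m (pt x)
          w , w∈ , e = ∈img⁻ m′ (subst (y ∈_) eq (∈img⁺ m m≢0 x∈ (maps-apply m (pt x))))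
          in w , w∈ , maps-⊙ (adj m′) m (maps-apply m (pt x)) (maps-adj m′ e)

      -- Dividing the matrix by a square root of its determinant makes the determinant 1 and leaves
      -- the image unchanged.
      square-det⇒InOrbit : ∀ m → ¬ det m ≡ 0# → IsSquare (det m) → InOrbit F B (img m)
      square-det⇒InOrbit m m≢0 (s , s²) = entries (inv s ⊡ m)
          (begin
            det (inv s ⊡ m)             ≡⟨ det-⊡ (inv s) m ⟩
            inv s * inv s * det m       ≡⟨ cong (inv s * inv s *_) s² ⟨
            inv s * inv s * (s * s)     ≡⟨ *-assoc _ _ _ ⟩
            inv s * (inv s * (s * s))   ≡⟨ cong (inv s *_) (inv*-cancel s s≢0) ⟩
            inv s * s                   ≡⟨ inverseˡ s≢0 ⟩
            1#                          ∎)
          (sym (img-⊡ (inv s) m (inv-nonzero s≢0) m≢0))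
        where
        s≢0 : ¬ s ≡ 0#
        s≢0 = nonzeroˡ (m≢0 ∘ trans (sym s²))
        entries : ∀ m′ {S} → det m′ ≡ 1# → S ≡ img m′ → InOrbit F B S
        entries (mat a b c d) e e′ = a , b , c , d , e , e′

      -- The quotient g by the orbit matrix has the determinant of m, is diagonal or antidiagonal,
      -- and sends 1 to some w in B. In the diagonal case a = wd and det g = wd²; in the
      -- antidiagonal case b = wc and det g = -wc².
      InOrbit⇒square-det : (∀ {x} → x ∈ B → IsSquare x) → IsSquare (- 1#) →
        ∀ m → ¬ det m ≡ 0# → InOrbit F B (img m) → IsSquare (det m)
      InOrbit⇒square-det B-squares -1-square m m≢0 (a , b , c , d , e , eq) =
        subst IsSquare det-g (go g 1↦w (equal-images⇒monomial m m′ m≢0 m′≢0 eq))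
        where
        m′ = mat a b c d
        m′≢0 : ¬ det m′ ≡ 0#
        m′≢0 = 1≢0 ∘ trans (sym e)
        g = adj m′ ⊙ m
        det-g : det g ≡ det m
        det-g = trans (det-⊙ (adj m′) m) (trans (cong (_* det m) (trans (det-adj m′) e)) (*-identityˡ _))
        1↦w : ∃ λ w → w ∈ B × Maps g (pt 1#) (pt w)
        1↦w = let
          y = apply m (pt 1#)
          w , w∈ , f = ∈img⁻ m′ (subst (y ∈_) eq (∈img⁺ m m≢0 1∈B (maps-apply m (pt 1#))))
          in w , w∈ , maps-⊙ (adj m′) m (maps-apply m (pt 1#)) (maps-adj m′ f)
        go : ∀ g → (∃ λ w → w ∈ B × Maps g (pt 1#) (pt w)) → IsDiagonalOrAnti g → IsSquare (det g)
        go (mat a b c d) (w , w∈ , mk f) (inj₁ (refl , refl)) = subst IsSquare (begin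
            w * (d * d)                            ≡⟨ solve 2 (λ w d → w :* (d :* d) := w :* (:0 :* :1 :+ d :* :1) :* d :- :0 :* :0) refl w d ⟩
            w * (0# * 1# + d * 1#) * d - 0# * 0#   ≡⟨ cong (λ z → z * d - 0# * 0#) f ⟨
            (a * 1# + 0# * 1#) * 1# * d - 0# * 0#  ≡⟨ solve 2 (λ a d → (a :* :1 :+ :0 :* :1) :* :1 :* d :- :0 :* :0 := a :* d :- :0 :* :0) refl a d ⟩
            a * d - 0# * 0#                        ∎)
          (square-product (B-squares w∈) (d , refl))
        go (mat a b c d) (w , w∈ , mk f) (inj₂ (refl , refl)) = subst IsSquare (begin
            - 1# * (w * (c * c))                   ≡⟨ solve 2 (λ w c → :- :1 :* (w :* (c :* c)) := :0 :* :0 :- w :* (c :* :1 :+ :0 :* :1) :* c) refl w c ⟩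
            0# * 0# - w * (c * 1# + 0# * 1#) * c   ≡⟨ cong (λ z → 0# * 0# - z * c) f ⟨
            0# * 0# - (0# * 1# + b * 1#) * 1# * c  ≡⟨ solve 2 (λ b c → :0 :* :0 :- (:0 :* :1 :+ b :* :1) :* :1 :* c := :0 :* :0 :- b :* c) refl b c ⟩
            0# * 0# - b * c                        ∎)
          (square-product -1-square (square-product (B-squares w∈) (c , refl)))

-- Counting blocks through three points by pairs of elements of B.

module Design {q : ℕ} (F : FiniteField q) (n : ℕ) (B : Subset q)
  (B-subgroup : IsMulSubgroupOfOrder F (3 ℕ.+ n) B)
  (k≢0 : ¬ FiniteField._·1 F (3 ℕ.+ n) ≡ FiniteField.0# F)
  (k-1≢0 : ¬ FiniteField._·1 F (2 ℕ.+ n) ≡ FiniteField.0# F)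
  (L : List (Subset (suc q))) (orbit : IsOrbitList F B L) where

  open Field F
  open Squares F
  open Projective F
  open Images B
  open Stabiliser n B-subgroup k≢0 k-1≢0
  open Subgroup (3 ℕ.+ n) B B-subgroup
  open ≡-Reasoning

  ∈L⇒InOrbit : ∀ {S} → S ∈ˡ L → InOrbit F B S
  ∈L⇒InOrbit = Equivalence.to (proj₂ orbit _)

  InOrbit⇒∈L : ∀ {S} → InOrbit F B S → S ∈ˡ L
  InOrbit⇒∈L = Equivalence.from (proj₂ orbit _)

  ∣block∣ : ∀ S → S ∈ˡ L → ∣ S ∣ ≡ 3 ℕ.+ n
  ∣block∣ S S∈ with a , b , c , d , e , refl ← ∈L⇒InOrbit S∈ =
    trans (∣img∣ (mat a b c d) (1≢0 ∘ trans (sym e))) (trans (sym (length-elements B)) length-B)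

  B∖1 : List (Fin q)
  B∖1 = _without_ Fin._≟_ B-elements 1#

  unique-B∖1 : Unique B∖1
  unique-B∖1 = Unique.filter⁺ _ (unique-elements B)

  ∈B∖1⁺ : ∀ {x} → x ∈ B → ¬ x ≡ 1# → x ∈ˡ B∖1
  ∈B∖1⁺ x∈ x≢1 = ∈-filter⁺ _ (∈⇒∈elements x∈) (x≢1 ∘ sym)

  ∈B∖1⁻ : ∀ {x} → x ∈ˡ B∖1 → x ∈ B × ¬ x ≡ 1#
  ∈B∖1⁻ x∈ with x∈′ , 1≢x ← ∈-filter⁻ (λ y → ¬? (1# Fin.≟ y)) {xs = B-elements} x∈ =
    ∈elements⇒∈ x∈′ , 1≢x ∘ sym

  Pair : Set
  Pair = Fin q × Fin q

  pairs : List Pair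
  pairs = distinctPairs Fin._≟_ B∖1

  length-pairs : length pairs ≡ (2 ℕ.+ n) ℕ.* (1 ℕ.+ n)
  length-pairs = length-distinctPairs Fin._≟_ (1 ℕ.+ n) unique-B∖1
    (ℕ.suc-injective (trans (length-without Fin._≟_ (unique-elements B) (∈⇒∈elements 1∈B)) length-B))

  record Admissible (u v : Fin q) : Set where
    field
      u∈B : u ∈ B
      v∈B : v ∈ B
      u≢1 : ¬ u ≡ 1#
      v≢1 : ¬ v ≡ 1#
      u≢v : ¬ u ≡ v

  ∈pairs⁻ : ∀ {u v} → (u , v) ∈ˡ pairs → Admissible u v
  ∈pairs⁻ uv∈ with u∈ , v∈ , u≢v ← ∈-distinctPairs⁻ Fin._≟_ B∖1 uv∈
    with u∈B , u≢1 ← ∈B∖1⁻ u∈ | v∈B , v≢1 ← ∈B∖1⁻ v∈ =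
    record { u∈B = u∈B ; v∈B = v∈B ; u≢1 = u≢1 ; v≢1 = v≢1 ; u≢v = u≢v }

  ∈pairs⁺ : ∀ {u v} → Admissible u v → (u , v) ∈ˡ pairs
  ∈pairs⁺ ad = ∈-distinctPairs⁺ Fin._≟_ (∈B∖1⁺ u∈B u≢1) (∈B∖1⁺ v∈B v≢1) u≢v
    where open Admissible ad

  invert : Pair → Pair
  invert (u , v) = inv u , inv v

  inv-unique : ∀ {x y} → ¬ x ≡ 0# → x * y ≡ 1# → y ≡ inv x
  inv-unique x≢0 e = *-cancelˡ x≢0 (trans e (sym (inverse _ x≢0)))

  inv-injective : ∀ {x y} → ¬ x ≡ 0# → ¬ y ≡ 0# → inv x ≡ inv y → x ≡ y
  inv-injective x≢0 y≢0 e = *-cancelˡ (inv-nonzero x≢0)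
    (trans (inverseˡ x≢0) (trans (sym (inverseˡ y≢0)) (cong (_* _) (sym e))))

  1≡inv1 : 1# ≡ inv 1#
  1≡inv1 = inv-unique 1≢0 (*-identityˡ 1#)

  invert-admissible : ∀ {u v} → Admissible u v → Admissible (inv u) (inv v)
  invert-admissible ad = record
    { u∈B = inv∈B u∈B
    ; v∈B = inv∈B v∈B
    ; u≢1 = λ e → u≢1 (inv-injective (B-nonzero u∈B) 1≢0 (trans e 1≡inv1))
    ; v≢1 = λ e → v≢1 (inv-injective (B-nonzero v∈B) 1≢0 (trans e 1≡inv1))
    ; u≢v = u≢v ∘ inv-injective (B-nonzero u∈B) (B-nonzero v∈B)
    }
    where open Admissible ad

  self-inverse : ∀ {x} → x ∈ B → ¬ x ≡ 1# → inv x ≡ x → x ≡ - 1#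
  self-inverse {x} x∈ x≢1 e = Sum.[ (λ x≡1 → contradiction x≡1 x≢1) , id ]
    (squares-equal (trans (*-identityˡ 1#) (trans (sym (inverse x (B-nonzero x∈))) (cong (x *_) e))))

  -- The only self-inverse element other than 1 is -1, so a fixed pair would have u = v = -1.
  invert-no-fixed-point : ∀ {u v} → Admissible u v → ¬ invert (u , v) ≡ (u , v)
  invert-no-fixed-point ad e = u≢v (trans (self-inverse u∈B u≢1 (Product.,-injectiveˡ e))
                                      (sym (self-inverse v∈B v≢1 (Product.,-injectiveʳ e))))
    where open Admissible ad

  -- A diagonal matrix acts as z ↦ sz and an antidiagonal one as z ↦ s/z; fixing 1 forces s = 1.
  fixes-1⇒id-or-inv : ∀ g → ¬ det g ≡ 0# → IsDiagonalOrAnti g → Maps g (pt 1#) (pt 1#) →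
    (∀ {x y} → ¬ x ≡ 0# → Maps g (pt x) (pt y) → y ≡ x) ⊎ (∀ {x y} → ¬ x ≡ 0# → Maps g (pt x) (pt y) → y ≡ inv x)
  fixes-1⇒id-or-inv (mat a b c d) det≢0 (inj₁ (refl , refl)) (mk e) = inj₁ λ {x} {y} _ (mk f) → *-cancelˡ d≢0 (begin
    d * y                        ≡⟨ solve 3 (λ d x y → d :* y := y :* (:0 :* x :+ d :* :1)) refl d x y ⟩
    y * (0# * x + d * 1#)        ≡⟨ f ⟨
    (a * x + 0# * 1#) * 1#       ≡⟨ solve 2 (λ a x → (a :* x :+ :0 :* :1) :* :1 := (a :* :1 :+ :0 :* :1) :* :1 :* x) refl a x ⟩
    (a * 1# + 0# * 1#) * 1# * x  ≡⟨ cong (_* x) e ⟩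
    1# * (0# * 1# + d * 1#) * x  ≡⟨ solve 2 (λ d x → :1 :* (:0 :* :1 :+ d :* :1) :* x := d :* x) refl d x ⟩
    d * x                        ∎)
    where
    d≢0 : ¬ d ≡ 0#
    d≢0 refl = det≢0 (solve 1 (λ a → a :* :0 :- :0 :* :0 := :0) refl a)
  fixes-1⇒id-or-inv (mat a b c d) det≢0 (inj₂ (refl , refl)) (mk e) = inj₂ λ {x} {y} x≢0 (mk f) →
    inv-unique x≢0 (*-cancelˡ c≢0 (begin
    c * (x * y)                  ≡⟨ solve 3 (λ c x y → c :* (x :* y) := y :* (c :* x :+ :0 :* :1)) refl c x y ⟩
    y * (c * x + 0# * 1#)        ≡⟨ f ⟨
    (0# * x + b * 1#) * 1#       ≡⟨ solve 2 (λ b x → (:0 :* x :+ b :* :1) :* :1 := (:0 :* :1 :+ b :* :1) :* :1) refl b x ⟩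
    (0# * 1# + b * 1#) * 1#      ≡⟨ e ⟩
    1# * (c * 1# + 0# * 1#)      ≡⟨ solve 1 (λ c → :1 :* (c :* :1 :+ :0 :* :1) := c :* :1) refl c ⟩
    c * 1#                       ∎))
    where
    c≢0 : ¬ c ≡ 0#
    c≢0 refl = det≢0 (solve 1 (λ b → :0 :* :0 :- b :* :0 := :0) refl b)

  _≟ˢ_ : DecidableEquality (Subset (suc q))
  _≟ˢ_ = Vec.≡-dec Bool._≟_

  open import Data.List.Membership.DecPropositional _≟ˢ_ using () renaming (_∈?_ to _∈ˡ?_)

  module Through {P Q R : Pt} (PQR : Unique (P ∷ Q ∷ R ∷ [])) where

    h : Matrix
    h = frame P Q R

    h≢0 : ¬ det h ≡ 0#
    h≢0 = go PQR
      where
      go : Unique (P ∷ Q ∷ R ∷ []) → ¬ det h ≡ 0#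
      go ((P≢Q ∷ P≢R ∷ []) ∷ (Q≢R ∷ []) ∷ _) = det-frame-nonzero P≢Q P≢R Q≢R

    block : Pair → Matrix
    block (u , v) = h ⊙ normal u v

    block-1 : ∀ u v → Maps (block (u , v)) (pt 1#) P
    block-1 u v = maps-⊙ h (normal u v) (normal-1 u v) (frame-∞ P Q R)
    block-u : ∀ u v → Maps (block (u , v)) (pt u) Q
    block-u u v = maps-⊙ h (normal u v) (normal-u u v) (frame-0 P Q R)
    block-v : ∀ u v → Maps (block (u , v)) (pt v) R
    block-v u v = maps-⊙ h (normal u v) (normal-v u v) (frame-1 P Q R)

    normal≢0 : ∀ {u v} → Admissible u v → ¬ det (normal u v) ≡ 0#
    normal≢0 ad = det-normal-nonzero u≢1 v≢1 u≢v
      where open Admissible ad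

    block≢0 : ∀ {u v} → Admissible u v → ¬ det (block (u , v)) ≡ 0#
    block≢0 {u} {v} ad = *-nonzero h≢0 (normal≢0 ad) ∘ trans (sym (det-⊙ h (normal u v)))

    triple⊆block : ∀ {u v} → Admissible u v → ∀ {x} → x ∈ˡ P ∷ Q ∷ R ∷ [] → x ∈ img (block (u , v))
    triple⊆block {u} {v} ad = λ
      { (here refl)                 → ∈img⁺ m (block≢0 ad) 1∈B (block-1 u v)
      ; (there (here refl))         → ∈img⁺ m (block≢0 ad) u∈B (block-u u v)
      ; (there (there (here refl))) → ∈img⁺ m (block≢0 ad) v∈B (block-v u v) }
      where
      open Admissible ad
      m = block (u , v)

    ⊡-nonzero : ∀ {r m m′} → m ≡ r ⊡ m′ → ¬ det m ≡ 0# → ¬ r ≡ 0#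
    ⊡-nonzero {m′ = m′} refl m≢0 refl = m≢0 (trans (det-⊡ 0# m′) (trans (cong (_* det m′) (zeroˡ 0#)) (zeroˡ _)))

    -- Precomposed with z ↦ 1/z, `normal u v` sends 1, 1/u, 1/v to ∞, 0, 1, so it is a scalar
    -- multiple of the normal matrix of the inverted pair. Inversion itself preserves B.
    img-invert : ∀ {u v} → Admissible u v → img (block (invert (u , v))) ≡ img (block (u , v))
    img-invert {u} {v} ad = go (normal-unique (N ⊙ inversion) {inv u} {inv v}
        (Admissible.v≢1 (invert-admissible ad))
        (maps-⊙ N inversion (maps-inversion (*-identityˡ 1#)) (normal-1 u v))
        (maps-⊙ N inversion (maps-inversion (inverseˡ (B-nonzero (Admissible.u∈B ad)))) (normal-u u v))
        (maps-⊙ N inversion (maps-inversion (inverseˡ (B-nonzero (Admissible.v∈B ad)))) (normal-v u v)))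
      where
      N = normal u v
      N′ = normal (inv u) (inv v)
      go : (∃ λ r → N ⊙ inversion ≡ r ⊡ N′) → img (h ⊙ N′) ≡ img (h ⊙ N)
      go (r , eq) = begin
        img (h ⊙ N′)                     ≡⟨ img-⊡ r (h ⊙ N′) r≢0 (block≢0 (invert-admissible ad)) ⟨
        img (r ⊡ (h ⊙ N′))               ≡⟨ cong img (⊙-⊡ r h N′) ⟨
        img (h ⊙ (r ⊡ N′))               ≡⟨ cong (λ z → img (h ⊙ z)) eq ⟨
        img (h ⊙ (N ⊙ inversion))        ≡⟨ cong img (⊙-assoc h N inversion) ⟨
        img ((h ⊙ N) ⊙ inversion)        ≡⟨ img-inversion (h ⊙ N) (block≢0 ad) ⟩
        img (h ⊙ N)                      ∎
        where
        r≢0 : ¬ r ≡ 0#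
        r≢0 = ⊡-nonzero eq (*-nonzero (normal≢0 ad) det-inversion≢0 ∘ trans (sym (det-⊙ N inversion)))

    -- Equal images make `adj m′ ⊙ m` diagonal or antidiagonal. Since it sends 1, u, v to 1, u′, v′,
    -- it fixes 1 and is the identity or inversion.
    img-fibre : ∀ {u v u′ v′} → Admissible u v → Admissible u′ v′ →
      img (block (u , v)) ≡ img (block (u′ , v′)) → (u′ , v′) ≡ (u , v) ⊎ (u′ , v′) ≡ invert (u , v)
    img-fibre {u} {v} {u′} {v′} ad ad′ eq =
      Sum.map (λ f → cong₂ _,_ (f u≢0 g-u) (f v≢0 g-v)) (λ f → cong₂ _,_ (f u≢0 g-u) (f v≢0 g-v))
        (fixes-1⇒id-or-inv (adj m′ ⊙ m) g≢0 (equal-images⇒monomial m m′ (block≢0 ad) (block≢0 ad′) eq)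
          (maps-⊙ (adj m′) m (block-1 u v) (maps-adj m′ (block-1 u′ v′))))
      where
      m = block (u , v)
      m′ = block (u′ , v′)
      u≢0 = B-nonzero (Admissible.u∈B ad)
      v≢0 = B-nonzero (Admissible.v∈B ad)
      g≢0 : ¬ det (adj m′ ⊙ m) ≡ 0#
      g≢0 = *-nonzero (block≢0 ad′) (block≢0 ad) ∘
        trans (sym (trans (det-⊙ (adj m′) m) (cong (_* det m) (det-adj m′))))
      g-u : Maps (adj m′ ⊙ m) (pt u) (pt u′)
      g-u = maps-⊙ (adj m′) m (block-u u v) (maps-adj m′ (block-u u′ v′))
      g-v : Maps (adj m′ ⊙ m) (pt v) (pt v′)
      g-v = maps-⊙ (adj m′) m (block-v u v) (maps-adj m′ (block-v u′ v′))

    block-onto : ∀ m → ¬ det m ≡ 0# → (∀ {x} → x ∈ˡ P ∷ Q ∷ R ∷ [] → x ∈ img m) →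
      ∃ λ uv → uv ∈ˡ pairs × img (block uv) ≡ img m
    block-onto m m≢0 PQR∈ = go (∈img⁻ m (PQR∈ (here refl))) (∈img⁻ m (PQR∈ (there (here refl))))
                               (∈img⁻ m (PQR∈ (there (there (here refl)))))
      where
      Preimage : Pt → Set
      Preimage X = ∃ λ x → x ∈ B × Maps m (pt x) X
      go : Preimage P → Preimage Q → Preimage R → ∃ λ uv → uv ∈ˡ pairs × img (block uv) ≡ img m
      go (x , x∈ , xP) (y , y∈ , yQ) (z , z∈ , zR) = (u , v) , ∈pairs⁺ ad , finish (normal-unique g v≢1 g-1 g-u g-v)
        where
        u = inv x * y
        v = inv x * z
        x≢0 = B-nonzero x∈
        -- Rotation by `x` moves 1, u, v to the preimages x, y, z; `m` takes these to P, Q, R, and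
        -- the adjugate of the frame takes those to ∞, 0, 1. So `g` is `normal u v` up to a scalar.
        g = (adj h ⊙ m) ⊙ scaling x
        g≢0 : ¬ det g ≡ 0#
        g≢0 e = *-nonzero (*-nonzero h≢0 m≢0) x≢0 (begin
          det h * det m * x                           ≡⟨ cong₂ (λ s t → s * det m * t) (det-adj h) (det-scaling x) ⟨
          det (adj h) * det m * det (scaling x)       ≡⟨ cong (_* det (scaling x)) (det-⊙ (adj h) m) ⟨
          det (adj h ⊙ m) * det (scaling x)           ≡⟨ det-⊙ (adj h ⊙ m) (scaling x) ⟨
          det g                                       ≡⟨ e ⟩
          0#                                          ∎)
        maps-g : ∀ {w w′ X Y} → x * w ≡ w′ → Maps m (pt w′) X → Maps h Y X → Maps g (pt w) Y
        maps-g {w} refl wX YX = maps-⊙ (adj h ⊙ m) (scaling x) (maps-scaling x w) (maps-⊙ (adj h) m wX (maps-adj h YX))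
        g-1 : Maps g (pt 1#) (∞ F)
        g-1 = maps-g (*-identityʳ x) xP (frame-∞ P Q R)
        g-u : Maps g (pt u) (pt 0#)
        g-u = maps-g (*inv-cancel y x≢0) yQ (frame-0 P Q R)
        g-v : Maps g (pt v) (pt 1#)
        g-v = maps-g (*inv-cancel z x≢0) zR (frame-1 P Q R)
        separate : ∀ {w w′ X Y} → Maps g (pt w) X → Maps g (pt w′) Y → w ≡ w′ → X ≡ Y
        separate e e′ refl = maps-unique g g≢0 e e′
        v≢1 : ¬ v ≡ 1#
        v≢1 e = Fin.0≢1+n (sym (separate g-v g-1 e))
        ad : Admissible u v
        ad = record
          { u∈B = *∈B (inv∈B x∈) y∈
          ; v∈B = *∈B (inv∈B x∈) z∈
          ; u≢1 = λ e → Fin.0≢1+n (sym (separate g-u g-1 e))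
          ; v≢1 = v≢1
          ; u≢v = λ e → 0≢1 (Fin.suc-injective (separate g-u g-v e))
          }
        finish : (∃ λ r → g ≡ r ⊡ normal u v) → img (block (u , v)) ≡ img m
        finish (r , eq) = begin
          img (block (u , v))                   ≡⟨ img-⊡ r (block (u , v)) (⊡-nonzero eq g≢0) (block≢0 ad) ⟨
          img (r ⊡ block (u , v))               ≡⟨ cong img (⊙-⊡ r h (normal u v)) ⟨
          img (h ⊙ (r ⊡ normal u v))            ≡⟨ cong (λ z → img (h ⊙ z)) eq ⟨
          img (h ⊙ ((adj h ⊙ m) ⊙ scaling x))   ≡⟨ cong (λ z → img (h ⊙ z)) (⊙-assoc (adj h) m (scaling x)) ⟩
          img (h ⊙ (adj h ⊙ (m ⊙ scaling x)))   ≡⟨ cong img (⊙-adj-⊙ h (m ⊙ scaling x)) ⟩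
          img (det h ⊡ (m ⊙ scaling x))         ≡⟨ img-⊡ (det h) (m ⊙ scaling x) h≢0 ms≢0 ⟩
          img (m ⊙ scaling x)                   ≡⟨ img-scaling m m≢0 x∈ ⟩
          img m                                 ∎
          where
          ms≢0 : ¬ det (m ⊙ scaling x) ≡ 0#
          ms≢0 = *-nonzero m≢0 (x≢0 ∘ trans (sym (det-scaling x))) ∘ trans (sym (det-⊙ m (scaling x)))

    block∈L? : ∀ uv → Dec (img (block uv) ∈ˡ L)
    block∈L? uv = img (block uv) ∈ˡ? L

    -- A block through P, Q, R is g B with g sending three points of B to P, Q, R.
    -- Rotating B makes the first of them 1; the only other choice is then obtained
    -- by inverting B.
    twice-blocks : ∀ T → (∀ {x} → x ∈ˡ P ∷ Q ∷ R ∷ [] → x ∈ T) → (∀ {x} → x ∈ T → x ∈ˡ P ∷ Q ∷ R ∷ []) →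
      length (filter block∈L? pairs) ≡ length (filter (T ⊆?_) L) ℕ.* 2
    twice-blocks T T⁺ T⁻ = length-two-to-one _≟ˢ_ (img ∘ block) invert (filter block∈L? pairs) (filter (T ⊆?_) L)
      (Unique.filter⁺ block∈L? (unique-distinctPairs Fin._≟_ unique-B∖1))
      (Unique.filter⁺ (T ⊆?_) (proj₁ orbit))
      (λ uv∈ → ∈-filter⁺ (T ⊆?_) (proj₂ (split uv∈)) (triple⊆block (proj₁ (split uv∈)) ∘ T⁻))
      (λ S∈ → onto (∈-filter⁻ (T ⊆?_) {xs = L} S∈))
      (λ uv∈ → let ad , S∈ = split uv∈ in
        ∈-filter⁺ block∈L? (∈pairs⁺ (invert-admissible ad)) (subst (_∈ˡ L) (sym (img-invert ad)) S∈) ,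
        img-invert ad , invert-no-fixed-point ad)
      (λ uv∈ uv∈′ → img-fibre (proj₁ (split uv∈)) (proj₁ (split uv∈′)))
      where
      split : ∀ {u v} → (u , v) ∈ˡ filter block∈L? pairs → Admissible u v × img (block (u , v)) ∈ˡ L
      split uv∈ = let uv∈′ , S∈ = ∈-filter⁻ block∈L? {xs = pairs} uv∈ in ∈pairs⁻ uv∈′ , S∈
      InPairs OverPairs : Subset (suc q) → Set
      InPairs S = ∃ λ uv → uv ∈ˡ pairs × img (block uv) ≡ S
      OverPairs S = ∃ λ uv → uv ∈ˡ filter block∈L? pairs × img (block uv) ≡ S
      select : ∀ {S} → S ∈ˡ L → InPairs S → OverPairs S
      select S∈ (uv , uv∈ , eq) = uv , ∈-filter⁺ block∈L? uv∈ (subst (_∈ˡ L) (sym eq) S∈) , eq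
      covered : ∀ {S} → T ⊆ S → InOrbit F B S → InPairs S
      covered T⊆S (a , b , c , d , e , refl) = block-onto (mat a b c d) (1≢0 ∘ trans (sym e)) (T⊆S ∘ T⁺)
      onto : ∀ {S} → S ∈ˡ L × T ⊆ S → OverPairs S
      onto (S∈ , T⊆S) = select S∈ (covered T⊆S (∈L⇒InOrbit S∈))

  module _ (2≢0 : ¬ 2 ·1 ≡ 0#) where
    open OddCharacteristic 2≢0

    -- Composing with multiplication by a nonsquare of B changes the square class of
    -- the determinant without moving B, so the orbits of PSL and PGL on B coincide.
    nonsquare-in-B⇒design : (∃ λ x → x ∈ B × ¬ IsSquare x) → IsDesign 3 (suc q) (3 ℕ.+ n) ((2 ℕ.+ n) ℕ.* (1 ℕ.+ n) / 2) L
    nonsquare-in-B⇒design (b , b∈ , ¬b) = ∣block∣ , balanced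
      where
      all-in-orbit : ∀ m → ¬ det m ≡ 0# → img m ∈ˡ L
      all-in-orbit m m≢0 with isSquare? (det m)
      ... | yes sq = InOrbit⇒∈L (square-det⇒InOrbit m m≢0 sq)
      ... | no ¬sq = InOrbit⇒∈L (subst (InOrbit F B) (img-scaling m m≢0 b∈)
          (square-det⇒InOrbit (m ⊙ scaling b) (*-nonzero m≢0 (B-nonzero b∈) ∘ trans (sym det-ms))
            (subst IsSquare (sym det-ms) (nonsquare-product m≢0 (B-nonzero b∈) ¬sq ¬b))))
        where
        det-ms : det (m ⊙ scaling b) ≡ det m * b
        det-ms = trans (det-⊙ m (scaling b)) (cong (det m *_) (det-scaling b))
      balanced : ∀ T → ∣ T ∣ ≡ 3 → length (filter (T ⊆?_) L) ≡ (2 ℕ.+ n) ℕ.* (1 ℕ.+ n) / 2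
      balanced T ∣T∣≡3 = let P , Q , R , u , T⁺ , T⁻ = size-3 T ∣T∣≡3 in through u T⁺ T⁻
        where
        through : ∀ {P Q R} → Unique (P ∷ Q ∷ R ∷ []) → (∀ {x} → x ∈ˡ P ∷ Q ∷ R ∷ [] → x ∈ T) →
          (∀ {x} → x ∈ T → x ∈ˡ P ∷ Q ∷ R ∷ []) → length (filter (T ⊆?_) L) ≡ (2 ℕ.+ n) ℕ.* (1 ℕ.+ n) / 2
        through u T⁺ T⁻ = begin
          length (filter (T ⊆?_) L)                   ≡⟨ m*n/n≡m _ 2 ⟨
          length (filter (T ⊆?_) L) ℕ.* 2 / 2         ≡⟨ cong (_/ 2) (twice-blocks T T⁺ T⁻) ⟨
          length (filter block∈L? pairs) / 2          ≡⟨ cong (λ xs → length xs / 2) (List.filter-all block∈L? all-blocks) ⟩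
          length pairs / 2                            ≡⟨ cong (_/ 2) length-pairs ⟩
          (2 ℕ.+ n) ℕ.* (1 ℕ.+ n) / 2                 ∎
          where
          open Through u
          all-blocks = All.tabulate {xs = pairs} λ {uv} uv∈ → all-in-orbit (block uv) (block≢0 (∈pairs⁻ uv∈))

    -- The triples {∞, 0, t} with t = 1 and with t a nonsquare lie in complementary
    -- sets of candidate blocks.
    squares⇒λ : (∀ {x} → x ∈ B → IsSquare x) → IsSquare (- 1#) →
      ∀ lam → IsDesign 3 (suc q) (3 ℕ.+ n) lam L → 4 ℕ.* lam ≡ (2 ℕ.+ n) ℕ.* (1 ℕ.+ n)
    squares⇒λ B-squares -1-square lam (_ , balanced) = let t , t≢0 , ¬t = ∃-nonsquare in begin
      4 ℕ.* lam                               ≡⟨ ℕ.*-comm 4 lam ⟩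
      lam ℕ.* 4                               ≡⟨ ℕ.*-distribˡ-+ lam 2 2 ⟩
      lam ℕ.* 2 ℕ.+ lam ℕ.* 2                 ≡⟨ cong₂ ℕ._+_
        (count 1# 1≢0 normal-square? (λ _ sq → square-quotient 1≢0 (1# , *-identityˡ 1#) sq)
          (λ _ sq → square-product (1# , *-identityˡ 1#) sq))
        (count t t≢0 (¬? ∘ normal-square?)
          (λ N≢0 sq sqN → ¬t (square-quotient N≢0 sqN (subst IsSquare (*-comm t _) sq)))
          (λ N≢0 → nonsquare-product t≢0 N≢0 ¬t)) ⟩
      length (filter normal-square? pairs) ℕ.+ length (filter (¬? ∘ normal-square?) pairs)
                                              ≡⟨ length-filter-¬ normal-square? pairs ⟩
      length pairs                            ≡⟨ length-pairs ⟩
      (2 ℕ.+ n) ℕ.* (1 ℕ.+ n)                 ∎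
      where
      det-uv : Pair → Fin q
      det-uv (u , v) = det (normal u v)
      normal-square? : ∀ uv → Dec (IsSquare (det-uv uv))
      normal-square? uv = isSquare? (det-uv uv)
      -- The frame of {∞, 0, t} has determinant t, so the block of a pair lies in the orbit exactly
      -- when t · `det-uv uv` is a square. `C` expresses this as `det-uv uv` being a square for t =
      -- 1 and a nonsquare for t a nonsquare.
      count : ∀ t → ¬ t ≡ 0# → {C : Pair → Set} (C? : ∀ uv → Dec (C uv)) →
        (∀ {uv} → ¬ det-uv uv ≡ 0# → IsSquare (t * det-uv uv) → C uv) →
        (∀ {uv} → ¬ det-uv uv ≡ 0# → C uv → IsSquare (t * det-uv uv)) →
        lam ℕ.* 2 ≡ length (filter C? pairs)
      count t t≢0 C? to from = begin
        lam ℕ.* 2                          ≡⟨ cong (ℕ._* 2) (balanced T (∣triple∣ u)) ⟨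
        length (filter (T ⊆?_) L) ℕ.* 2    ≡⟨ twice-blocks T ∈triple⁺ ∈triple⁻ ⟨
        length (filter block∈L? pairs)     ≡⟨ length-filter-⇔ block∈L? C? pairs
          (λ uv∈ S∈ → to (normal≢0 (∈pairs⁻ uv∈)) (subst IsSquare (det-block _)
            (InOrbit⇒square-det B-squares -1-square (block _) (block≢0 (∈pairs⁻ uv∈)) (∈L⇒InOrbit S∈))))
          (λ uv∈ c → InOrbit⇒∈L (square-det⇒InOrbit (block _) (block≢0 (∈pairs⁻ uv∈))
            (subst IsSquare (sym (det-block _)) (from (normal≢0 (∈pairs⁻ uv∈)) c)))) ⟩
        length (filter C? pairs)           ∎
        where
        u : Unique (∞ F ∷ pt 0# ∷ pt t ∷ [])
        u = ((λ ()) ∷ (λ ()) ∷ []) ∷ ((t≢0 ∘ sym ∘ Fin.suc-injective) ∷ []) ∷ [] ∷ []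
        T = triple (∞ F) (pt 0#) (pt t)
        open Through u
        det-block : ∀ uv → det (block uv) ≡ t * det-uv uv
        det-block (u , v) = trans (det-⊙ h (normal u v)) (cong (_* det-uv (u , v)) (trans
          (det-frame (∞ F) (pt 0#) (pt t))
          (solve 1 (λ t → (t :* :1 :- :0 :* :1) :* (:1 :* :1 :- t :* :0) :* (:1 :* :1 :- :0 :* :0) := t) refl t)))

-- Specialisation to k = 3 + n and the two parities of e.

open import Data.Nat using (_+_; _*_; _∸_; _^_; _<_; _≤_)

theorem2p5 : (q p k e : ℕ) (F : FiniteField q) →
  Σ ℕ (λ n → (1 ≤ n) × (q ≡ p ^ n)) →
  HasCharacteristic F p →
  q % 4 ≡ 1 →
  k * e ≡ q ∸ 1 → 3 < k → k < q ∸ 1 → k < p →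
  (B : Subset q) → IsMulSubgroupOfOrder F k B →
  (L : List (Subset (suc q))) → IsOrbitList F B L →
  ((e % 2 ≡ 1) →
     IsDesign 3 (suc q) k (((k ∸ 1) * (k ∸ 2)) / 2) L)
  × ((e % 2 ≡ 0) → (lam : ℕ) → IsDesign 3 (suc q) k lam L →
     4 * lam ≡ (k ∸ 1) * (k ∸ 2))
theorem2p5 q p (suc (suc (suc n))) e F _ char q%4 ke≡q-1 _ _ k<p B B-subgroup L orbit =
    (λ e-odd → nonsquare-in-B⇒design 2≢0 (odd-index⇒∃-nonsquare 2≢0 e ke≡units e-odd)) ,
    (λ e-even → squares⇒λ 2≢0 (even-index⇒squares 2≢0 e ke≡units e-even)
      (OddCharacteristic.-1-square 2≢0 q%4))
  where
  open Field F
  open Squares F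
  open Subgroup (3 ℕ.+ n) B B-subgroup
  k≢0 : ¬ (3 ℕ.+ n) ·1 ≡ 0#
  k≢0 = ·1-nonzero char (3 ℕ.+ n) k<p
  k-1≢0 : ¬ (2 ℕ.+ n) ·1 ≡ 0#
  k-1≢0 = ·1-nonzero char (2 ℕ.+ n) (ℕ.<-trans (ℕ.n<1+n _) k<p)
  2≢0 : ¬ 2 ·1 ≡ 0#
  -- The characteristic is odd, because p exceeds k, which is at least 3.
  2≢0 = ·1-nonzero char 2 (ℕ.≤-<-trans (ℕ.s≤s (ℕ.s≤s ℕ.z≤n)) k<p)
  open Design F n B B-subgroup k≢0 k-1≢0 L orbit
  ke≡units : (3 ℕ.+ n) ℕ.* e ≡ length units
  ke≡units = trans ke≡q-1 (cong (ℕ._∸ 1) (sym length-units))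
theorem2p5 q p (suc (suc zero)) e F _ _ _ _ (ℕ.s≤s (ℕ.s≤s ()))
theorem2p5 q p (suc zero) e F _ _ _ _ (ℕ.s≤s ())
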